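{- There exists a family of unsatisfiable CNF formulas, indexed by $n$, such that the $n$-th formula $F$ has a Stabbing Planes refutation of size $\mathrm{poly}(n)$, but every Stabbing Planes refutation of $F$ has depth $\Omega(n^{1/8}/\log n)$.
   Context: Encoding of CNFs: a CNF formula is translated to a system of linear inequalities by including $0\le x_i\le 1$ for every variable $x_i$, and for every clause $\bigvee_{i\in I}x_i\vee\bigvee_{j\in J}\neg x_j$ the inequality $\sum_{i\in I}x_i+\sum_{j\in J}(1-x_j)\ge 1$. A Stabbing Planes refutation of a CNF is a refutation of this system. Stabbing Planes (SP): let $Ax\ge b$ be a system of integer linear inequalities in real variables with no integer solution. An SP refutation of it is a directed binary tree whose edges are labelled by integer linear inequalities such that: (internal nodes) if the right outgoing edge of an internal node is labelled $cx\ge d$ ($c$ an integer vector, $d$ an integer), then its left outgoing edge is labelled $cx\le d-1$; (leaves) each leaf is labelled with a conic (nonnegative) combination of inequalities of $Ax\ge b$ and of inequalities labelling the path from the root to that leaf which yields $0\ge 1$. The depth is the length of the longest root-to-leaf path; the size is the bit-length needed to encode the whole tree. -}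

module Defs where

open import Data.Bool using (Bool; true; false; if_then_else_)
open import Data.Fin using (Fin)
open import Data.Fin.Subset using (Subset; _∈_; ∣_∣)
open import Data.Integer as ℤ using (ℤ; +_; 0ℤ; 1ℤ)
open import Data.List using (List; length)
import Data.List.Relation.Unary.All as List
open import Data.Nat as ℕ using (ℕ; suc; _⊔_)
open import Data.Nat.Logarithm using (⌈log₂_⌉)
open import Data.Product using (∃; ∃-syntax; _×_)
open import Data.Rational as ℚ using (ℚ; 0ℚ; 1ℚ; NonNegative; ↥_; ↧_)
open import Data.Sum using (_⊎_)
open import Data.Vec using (Vec; []; _∷_; _++_; map; zipWith; foldr′; sum; lookup; replicate; tabulate; fromList; _[_]≔_)
open import Data.Vec.Relation.Unary.All using (All)
open import Relation.Binary.PropositionalEquality using (_≡_)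
open import Relation.Nullary using (¬_)

-- The clause ⋁_{i ∈ pos} xᵢ ∨ ⋁_{j ∈ neg} ¬ xⱼ.
record Clause (v : ℕ) : Set where
  constructor clause
  field
    pos neg : Subset v

CNF : ℕ → Set
CNF v = List (Clause v)

Assignment : ℕ → Set
Assignment v = Fin v → Bool

_⊨_ : ∀ {v} → Assignment v → Clause v → Set
α ⊨ C = (∃[ i ] (i ∈ pos × α i ≡ true)) ⊎ (∃[ j ] (j ∈ neg × α j ≡ false))
  where open Clause C

Satisfiable : ∀ {v} → CNF v → Set
Satisfiable {v} F = ∃ λ (α : Assignment v) → List.All (α ⊨_) F

Unsatisfiable : ∀ {v} → CNF v → Set
Unsatisfiable F = ¬ Satisfiable F

-- c ≥′ d is the inequality c·x ≥ d in v real variables x.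
infix 4 _≥′_ _≤′_
record Inequality (v : ℕ) : Set where
  constructor _≥′_
  field
    coeffs : Vec ℤ v
    bound  : ℤ

open Inequality public

-- c·x ≤ d, written as (-c)·x ≥ -d.
_≤′_ : ∀ {v} → Vec ℤ v → ℤ → Inequality v
c ≤′ d = map ℤ.-_ c ≥′ ℤ.- d

System : ℕ → ℕ → Set
System v m = Vec (Inequality v) m

unit : ∀ {v} → Fin v → Vec ℤ v
unit i = replicate _ 0ℤ [ i ]≔ 1ℤ

-- ∑_{i ∈ pos} xᵢ + ∑_{j ∈ neg} (1 - xⱼ) ≥ 1, with the constant ∣ neg ∣ moved to
-- the right-hand side.
clauseInequality : ∀ {v} → Clause v → Inequality v
clauseInequality (clause pos neg) =
  zipWith (λ p q → indicator p ℤ.- indicator q) pos neg ≥′ 1ℤ ℤ.- + ∣ neg ∣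
  where
  indicator : Bool → ℤ
  indicator b = if b then 1ℤ else 0ℤ

encode : ∀ {v} (F : CNF v) → System v (v ℕ.+ (v ℕ.+ length F))
encode F = tabulate (λ i → unit i ≥′ 0ℤ)
        ++ tabulate (λ i → unit i ≤′ 1ℤ)
        ++ map clauseInequality (fromList F)

∑ : ∀ {m} → Vec ℚ m → ℚ
∑ = foldr′ ℚ._+_ 0ℚ

fromℤ : ℤ → ℚ
fromℤ z = z ℚ./ 1

-- The combination of the inequalities of S with multipliers ws is literally the
-- inequality 0 ≥ 1.  Multipliers are rational so that they have a bit-length.
record ConicContradiction {v m} (S : System v m) : Set where
  field
    ws          : Vec ℚ m
    nonNegative : All NonNegative ws
    lhs≡0       : ∀ i → ∑ (zipWith (λ w e → w ℚ.* fromℤ (lookup (coeffs e) i)) ws S) ≡ 0ℚ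
    rhs≡1       : ∑ (zipWith (λ w e → w ℚ.* fromℤ (bound e)) ws S) ≡ 1ℚ

-- A (sub)tree is indexed by the system available at its root: the original
-- inequalities together with the labels of the edges above it.  In node c d l r
-- the edge to l is labelled c·x ≤ d - 1 and the edge to r is labelled c·x ≥ d.
data SP {v : ℕ} {m : ℕ} (S : System v m) : Set where
  leaf : ConicContradiction S → SP S
  node : (c : Vec ℤ v) (d : ℤ) → SP ((c ≤′ d ℤ.- 1ℤ) ∷ S) → SP ((c ≥′ d) ∷ S) → SP S

SPRefutation : ∀ {v} → CNF v → Set
SPRefutation F = SP (encode F)

depth : ∀ {v m} {S : System v m} → SP S → ℕ
depth (leaf _)       = 0
depth (node _ _ l r) = suc (depth l ⊔ depth r)

-- A sign bit and the ⌈log₂ (∣z∣ + 1)⌉ binary digits of ∣z∣.  Delimiters would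
-- change bit-lengths only by a constant factor.
bitsℤ : ℤ → ℕ
bitsℤ z = 1 ℕ.+ ⌈log₂ suc ℤ.∣ z ∣ ⌉

bitsℚ : ℚ → ℕ
bitsℚ q = bitsℤ (↥ q) ℕ.+ bitsℤ (↧ q)

bitsInequality : ∀ {v} → Inequality v → ℕ
bitsInequality e = sum (map bitsℤ (coeffs e)) ℕ.+ bitsℤ (bound e)

-- Every node costs one bit for the shape of the tree, on top of the labels of
-- leaves and edges.
size : ∀ {v m} {S : System v m} → SP S → ℕ
size (leaf k)       = 1 ℕ.+ sum (map bitsℚ (ConicContradiction.ws k))
size (node c d l r) = 1 ℕ.+ (bitsInequality (c ≤′ d ℤ.- 1ℤ) ℕ.+ size l)
                        ℕ.+ (bitsInequality (c ≥′ d) ℕ.+ size r)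

{-# OPTIONS --safe #-}
module Submission where

-- The formula describes f : {0, …, n} → {0, …, n} with f(0) > 0 and f(i) > i ⇒ f(f(i)) > f(i); iterating f
-- from 0 would climb forever.  Every value is hidden behind a pointer, f(i) = y_i[x_i], with x_i one of m
-- slots.  For k = n, …, 0 derive in turn that no i < k points to k: a polynomial number of cuts, and each of
-- them is refuted on one side by short leaves, so the whole refutation is a polynomial-size caterpillar.
--
-- Depth is bounded from below by an adversary in the style of Raz and McKenzie.  It keeps a set A of
-- pointer vectors x and, for every i, a set B_i of tables y_i.  A branching c·(x, y) ≥ d is a sum of a function
-- of x and of functions of the single y_i, so keeping the upper halves of all the sets with respect to
-- their medians, or else all the lower halves, decides it.  A node i is given up when A is sparse in
-- direction i.  Then, because A is thick (every nonempty fibre has at least D points), some table y_i ∈ B_i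
-- shows the value of the adversary's choice on every fibre, and A is projected along i.  Projecting raises the
-- density of A, halving lowers it by a constant factor, so there are at most as many nodes given up
-- as branchings made.  The adversary extends the path 0 → f(0) → … to the next free node when its end is given up,
-- and otherwise answers f(i) = 0, which leaves every clause unfalsified until no free node remains.  In a leaf,
-- bisecting the conic combination by O(log n) further branchings finds one violated axiom.

open import Data.Bool as Bool using (Bool; true; false; _∧_; not; if_then_else_)
open import Data.Bool.Properties as Bool using ()
open import Data.Empty using (⊥)
open import Data.Fin as Fin using (Fin; zero; suc; punchIn; punchOut; toℕ)
open import Data.Fin.Properties as Fin using ()
open import Data.Fin.Subset as Subset using (Subset; ∣_∣)
open import Data.Integer as ℤ using (ℤ; +_; -[1+_]; 0ℤ; 1ℤ; -1ℤ)
open import Data.Integer.Properties as ℤ using ()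
open import Data.Integer.Tactic.RingSolver as ℤRing using ()
open import Data.List as List using (List; []; _∷_; length; take; drop; _++_)
open import Data.List.Membership.DecPropositional as ListMembership using ()
open import Data.List.Membership.Propositional using (_∈_)
open import Data.List.Membership.Propositional.Properties using (∈-tabulate⁺; ∈-++⁺ˡ; ∈-++⁺ʳ; ∈-map⁺; ∈-allFin; ∈-filter⁺; ∈-filter⁻; ∈-cartesianProduct⁺)
open import Data.List.Properties using (length-take; length-drop; take++drop≡id; length-tabulate; length-filter; length-++; length-map)
open import Data.List.Relation.Unary.All as ListAll using ([]; _∷_)
open import Data.List.Relation.Unary.All.Properties as ListAll using ()
open import Data.List.Relation.Unary.AllPairs using ([]; _∷_)
open import Data.List.Relation.Unary.Any using (Any; here; there)
open import Data.List.Relation.Unary.Any.Properties as Any using ()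
open import Data.List.Relation.Unary.Unique.Propositional using (Unique)
open import Data.List.Relation.Unary.Unique.Propositional.Properties as Unique using ()
open import Data.Nat using (ℕ; zero; suc; _+_; _*_; _^_; _⊔_; _≤_; _<_; _≥_; z≤n; s≤s; _≤?_; _<?_; NonZero; >-nonZero; >-nonZero⁻¹)
open import Data.Nat.Coprimality as Coprime using (Coprime)
open import Data.Nat.Induction using (<-wellFounded)
open import Data.Nat.Logarithm using (⌊log₂_⌋; ⌊log₂⌋-mono-≤; ⌈log₂⌉-mono-≤; ⌈log₂2^n⌉≡n)
open import Data.Nat.Properties
open import Data.Nat.Tactic.RingSolver using (solve-∀)
open import Data.Product using (∃; ∃-syntax; Σ-syntax; _×_; _,_; proj₁; proj₂; map₂)
open import Data.Rational as ℚ using (ℚ; mkℚ; ↥_; ↧_; toℚᵘ; NonNegative)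
open import Data.Rational.Properties as ℚ using ()
open import Data.Rational.Unnormalised as ℚᵘ using (mkℚᵘ; _≃_; *≡*)
open import Data.Rational.Unnormalised.Properties as ℚᵘ using ()
open import Data.Sum as Sum using (_⊎_; inj₁; inj₂)
open import Data.Sum.Properties using (inj₁-injective; inj₂-injective)
open import Data.Vec as Vec using (Vec; []; _∷_; lookup; insertAt; removeAt; zipWith)
open import Data.Vec.Membership.Propositional using () renaming (_∈_ to _∈ᵥ_)
open import Data.Vec.Membership.Propositional.Properties as Vec using (∈-fromList⁺)
open import Data.Vec.Properties using (removeAt-insertAt; insertAt-removeAt; insertAt-lookup; insertAt-punchIn; ≡-dec; lookup-zipWith; lookup∘tabulate; lookup⇒[]=; []=⇒lookup; lookup-map; lookup∘update; lookup∘update′; lookup-replicate)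
open import Data.Vec.Relation.Unary.All as VecAll using (All; []; _∷_)
open import Data.Vec.Relation.Unary.All.Properties as VecAll using ()
open import Data.Vec.Relation.Unary.Any using (here; there)
open import Function using (_∘_; const; case_of_; id)
open import Induction.WellFounded using (Acc; acc)
open import Relation.Binary.Definitions using (tri<; tri≈; tri>)
open import Relation.Binary.PropositionalEquality
open import Relation.Nullary using (Dec; yes; no; does; ¬_; contradiction; ¬?)
open import Relation.Nullary.Decidable using (map′; dec-true; dec-false; _×-dec_)
open import Algebra.Properties.Semiring.Sum +-*-semiring using (sum; sum-cong-≗; ∑-distrib-+; ∑-comm; *-distribˡ-sum; sum-replicate-zero)
open import Algebra.Properties.Semiring.Sum ℤ.+-*-semiring as ℤ∑ using ()
open import Defs

-- Finite sums and sets of vectors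

-- The violated axiom found in a leaf has negative slack at every point of the current box, so the
-- adversary need only ensure that each axiom holds somewhere in every later box. A move clause
-- fails throughout a box only if its pointers are constant there, and thickness lets no pointer of
-- a free node be constant: this is what the pointers buy.
--
-- The constants come from one ledger. A branching costs `A` a factor 2 at the median and another 2
-- in restoring thickness, hence `4 ^ t`; the second loss is only 2 because sparse directions are
-- removed first. Giving up a node must therefore gain a factor 4: sparse means that the average
-- nonempty fibre has fewer than `4 * (N * D)` points, and `m` is at least four times that. Each `B`
-- of a free node loses a factor 2 per branching, so a table hitting all fibres, at most `m ^ N` of
-- them, survives once `(N / n) ^ D` exceeds `m ^ N * 2 ^ N`. This asks for `D` somewhat above
-- `N ^ 2`; the choice below is of order `N ^ 4`. With about `n ^ 2` nodes at index `n`, the depth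
-- comes out as at least `n` for large `n`.

sum-mono : ∀ {n} {f g : Fin n → ℕ} → (∀ i → f i ≤ g i) → sum f ≤ sum g
sum-mono {zero}  f≤g = z≤n
sum-mono {suc n} f≤g = +-mono-≤ (f≤g zero) (sum-mono (f≤g ∘ suc))

sum-const : ∀ n c → sum {n} (const c) ≡ n * c
sum-const zero    c = refl
sum-const (suc n) c = cong (_+_ c) (sum-const n c)

term≤sum : ∀ {n} (f : Fin n → ℕ) i → f i ≤ sum f
term≤sum f zero    = m≤m+n _ _
term≤sum f (suc i) = ≤-trans (term≤sum (f ∘ suc) i) (m≤n+m _ _)

boxSum : ∀ {m} k → (Vec (Fin m) k → ℕ) → ℕ
boxSum zero    f = f []
boxSum (suc k) f = sum λ j → boxSum k (f ∘ (j ∷_))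

module _ {m : ℕ} where

  boxSum-mono : ∀ k {f g : Vec (Fin m) k → ℕ} → (∀ a → f a ≤ g a) → boxSum k f ≤ boxSum k g
  boxSum-mono zero    f≤g = f≤g []
  boxSum-mono (suc k) f≤g = sum-mono λ j → boxSum-mono k λ a → f≤g (j ∷ a)

  boxSum-cong : ∀ k {f g : Vec (Fin m) k → ℕ} → (∀ a → f a ≡ g a) → boxSum k f ≡ boxSum k g
  boxSum-cong zero    f≡g = f≡g []
  boxSum-cong (suc k) f≡g = sum-cong-≗ λ j → boxSum-cong k λ a → f≡g (j ∷ a)

  boxSum-+ : ∀ k (f g : Vec (Fin m) k → ℕ) → boxSum k (λ a → f a + g a) ≡ boxSum k f + boxSum k g
  boxSum-+ zero    f g = refl
  boxSum-+ (suc k) f g = trans (sum-cong-≗ λ j → boxSum-+ k (f ∘ (j ∷_)) (g ∘ (j ∷_)))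
                               (∑-distrib-+ (λ j → boxSum k (f ∘ (j ∷_)))
                                            (λ j → boxSum k (g ∘ (j ∷_))))

  boxSum-* : ∀ k c (f : Vec (Fin m) k → ℕ) → boxSum k (λ a → c * f a) ≡ c * boxSum k f
  boxSum-* zero    c f = refl
  boxSum-* (suc k) c f = trans (sum-cong-≗ λ j → boxSum-* k c (f ∘ (j ∷_)))
                               (sym (*-distribˡ-sum c λ j → boxSum k (f ∘ (j ∷_))))

  boxSum-const : ∀ k c → boxSum {m} k (const c) ≡ m ^ k * c
  boxSum-const zero    c = sym (+-identityʳ c)
  boxSum-const (suc k) c = trans (sum-cong-≗ {m} λ j → boxSum-const k c)
                          (trans (sum-const m _) (sym (*-assoc m (m ^ k) c)))

  boxSum-sum : ∀ k {n} (f : Vec (Fin m) k → Fin n → ℕ) →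
               boxSum k (λ a → sum (f a)) ≡ sum (λ i → boxSum k (λ a → f a i))
  boxSum-sum zero    f = refl
  boxSum-sum (suc k) f = trans (sum-cong-≗ λ j → boxSum-sum k (f ∘ (j ∷_)))
                               (∑-comm λ j i → boxSum k (λ a → f (j ∷ a) i))

  boxSum-insertAt : ∀ k i (f : Vec (Fin m) (suc k) → ℕ) →
                    boxSum (suc k) f ≡ boxSum k (λ a → sum (λ j → f (insertAt a i j)))
  boxSum-insertAt k       zero    f = sym (boxSum-sum k λ a j → f (j ∷ a))
  boxSum-insertAt (suc k) (suc i) f = sum-cong-≗ λ j → boxSum-insertAt k i (f ∘ (j ∷_))

  term≤boxSum : ∀ k (f : Vec (Fin m) k → ℕ) a → f a ≤ boxSum k f
  term≤boxSum zero    f []      = ≤-refl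
  term≤boxSum (suc k) f (j ∷ a) = ≤-trans (term≤boxSum k (f ∘ (j ∷_)) a) (term≤sum _ j)

  search : ∀ {p} k {P : Vec (Fin m) k → Set p} → (∀ a → Dec (P a)) → Dec (∃ P)
  search zero    P? = map′ ([] ,_) (λ { ([] , p) → p }) (P? [])
  search (suc k) P? = map′ (λ (j , a , p) → j ∷ a , p) (λ { (j ∷ a , p) → j , a , p })
                        (Fin.any? λ j → search k (P? ∘ (j ∷_)))

boxSum-comm : ∀ {m n} k l (f : Vec (Fin m) k → Vec (Fin n) l → ℕ) →
              boxSum k (λ a → boxSum l (f a)) ≡ boxSum l (λ b → boxSum k (λ a → f a b))
boxSum-comm zero    l f = refl
boxSum-comm (suc k) l f = trans (sum-cong-≗ λ j → boxSum-comm k l (f ∘ (j ∷_)))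
                                (sym (boxSum-sum l λ b j → boxSum k (λ a → f (j ∷ a) b)))

VecSet : ℕ → ℕ → Set
VecSet m k = Vec (Fin m) k → Bool

⟦_⟧ : Bool → ℕ
⟦ b ⟧ = if b then 1 else 0

infix 4 _∈ˢ_
_∈ˢ_ : ∀ {m k} → Vec (Fin m) k → VecSet m k → Set
a ∈ˢ A = A a ≡ true

count : ∀ {m k} → VecSet m k → ℕ
count {k = k} A = boxSum k (⟦_⟧ ∘ A)

⟦⟧≤1 : ∀ b → ⟦ b ⟧ ≤ 1
⟦⟧≤1 true  = ≤-refl
⟦⟧≤1 false = z≤n

⟦⟧-mono : ∀ {b c} → (b ≡ true → c ≡ true) → ⟦ b ⟧ ≤ ⟦ c ⟧
⟦⟧-mono {true}  imp rewrite imp refl = ≤-refl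
⟦⟧-mono {false} imp = z≤n

module _ {m k : ℕ} where

  count-mono : {A B : VecSet m k} → (∀ a → a ∈ˢ A → a ∈ˢ B) → count A ≤ count B
  count-mono A⊆B = boxSum-mono k λ a → ⟦⟧-mono (A⊆B a)

  count≤ : (A : VecSet m k) → count A ≤ m ^ k
  count≤ A = ≤-trans (boxSum-mono k (⟦⟧≤1 ∘ A))
                     (≤-reflexive (trans (boxSum-const k 1) (*-identityʳ _)))

  ∈⇒count>0 : (A : VecSet m k) → ∀ a → a ∈ˢ A → 0 < count A
  ∈⇒count>0 A a a∈A = subst (λ b → ⟦ b ⟧ ≤ count A) a∈A (term≤boxSum k (⟦_⟧ ∘ A) a)

  count>0⇒∈ : (A : VecSet m k) → 0 < count A → ∃ (_∈ˢ A)
  count>0⇒∈ A A>0 with search k (λ a → A a Bool.≟ true)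
  ... | yes ∃a = ∃a
  ... | no ∄a  = contradiction
    (≤-trans A>0 (≤-trans (boxSum-mono k λ a → ⟦⟧-mono {A a} {false} λ p → contradiction (a , p) ∄a)
                          (≤-reflexive (trans (boxSum-const k 0) (*-zeroʳ (m ^ k))))))
    λ ()

  count-strict : {A B : VecSet m k} → (∀ a → a ∈ˢ A → a ∈ˢ B) →
                 ∀ b → b ∈ˢ B → ¬ b ∈ˢ A → count A < count B
  count-strict {A} {B} A⊆B b b∈B b∉A = begin
    suc (count A)                        ≡⟨ +-comm 1 (count A) ⟩
    count A + 1                          ≤⟨ +-monoʳ-≤ (count A) (∈⇒count>0 B∖A b b∈B∖A) ⟩
    count A + count B∖A                  ≡⟨ boxSum-+ k (⟦_⟧ ∘ A) (⟦_⟧ ∘ B∖A) ⟨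
    boxSum k (λ a → ⟦ A a ⟧ + ⟦ B∖A a ⟧) ≤⟨ boxSum-mono k (λ a → pointwise (A a) (B a) (A⊆B a)) ⟩
    count B                              ∎
    where
    open ≤-Reasoning
    B∖A : VecSet m k
    B∖A a = B a ∧ not (A a)
    b∈B∖A : b ∈ˢ B∖A
    b∈B∖A rewrite b∈B | Bool.¬-not b∉A = refl
    pointwise : ∀ x y → (x ≡ true → y ≡ true) → ⟦ x ⟧ + ⟦ y ∧ not x ⟧ ≤ ⟦ y ⟧
    pointwise true  y     x⇒y rewrite x⇒y refl = ≤-refl
    pointwise false true  x⇒y = ≤-refl
    pointwise false false x⇒y = z≤n

-- Medians of integer-valued functions on a set

∧-intro : ∀ {p} {P : Set p} {b} (d : Dec P) → b ≡ true → P → b ∧ does d ≡ true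
∧-intro d refl p = dec-true d p

∧-elimˡ : ∀ b {c} → b ∧ c ≡ true → b ≡ true
∧-elimˡ true _ = refl

∧-elimʳ : ∀ {p} {P : Set p} b (d : Dec P) → b ∧ does d ≡ true → P
∧-elimʳ true (yes p) _ = p

-- A discrete intermediate value principle; it locates a median as a level at which the upper part
-- stops containing half of the set.
crossing : ∀ {p} {P : ℕ → Set p} → (∀ s → Dec (P s)) → P 0 → ∀ n → ¬ P n → ∃[ s ] P s × ¬ P (suc s)
crossing P? P0 zero    ¬Pn = contradiction P0 ¬Pn
crossing P? P0 (suc n) ¬Pn with P? n
... | yes Pn = n , Pn , ¬Pn
... | no ¬Pm = crossing P? P0 n ¬Pm

-∣i∣≤i : ∀ i → ℤ.- (+ ℤ.∣ i ∣) ℤ.≤ i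
-∣i∣≤i (+ zero)  = ℤ.≤-refl
-∣i∣≤i (+ suc n) = ℤ.-≤+
-∣i∣≤i -[1+ n ]  = ℤ.≤-refl

i≤∣i∣ : ∀ i → i ℤ.≤ + ℤ.∣ i ∣
i≤∣i∣ (+ n)    = ℤ.≤-refl
i≤∣i∣ -[1+ n ] = ℤ.-≤+

module _ {m k : ℕ} where

  count-∪ : {A B C : VecSet m k} → (∀ a → a ∈ˢ A → a ∈ˢ B ⊎ a ∈ˢ C) → count A ≤ count B + count C
  count-∪ {A} {B} {C} cover = begin
    count A                              ≤⟨ boxSum-mono k (λ a → pointwise (cover a)) ⟩
    boxSum k (λ a → ⟦ B a ⟧ + ⟦ C a ⟧)   ≡⟨ boxSum-+ k (⟦_⟧ ∘ B) (⟦_⟧ ∘ C) ⟩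
    count B + count C                    ∎
    where
    open ≤-Reasoning
    pointwise : ∀ {x y z} → (x ≡ true → y ≡ true ⊎ z ≡ true) → ⟦ x ⟧ ≤ ⟦ y ⟧ + ⟦ z ⟧
    pointwise {false} _ = z≤n
    pointwise {true} {y} {z} f with f refl
    ... | inj₁ refl = s≤s z≤n
    ... | inj₂ refl = m≤n+m 1 ⟦ y ⟧

  atLeast atMost : VecSet m k → (Vec (Fin m) k → ℤ) → ℤ → VecSet m k
  atLeast A f t a = A a ∧ does (t ℤ.≤? f a)
  atMost  A f t a = A a ∧ does (f a ℤ.≤? t)

  opaque
    -- All values lie between `-M` and `M`, so as the level rises from `-M` to `M + 1` the upper
    -- part shrinks from all of `A` to nothing. At the crossing, at least half of `A` lies at or
    -- above `t`, and less than half at or above `t + 1`, so more than half lies at or below `t`.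
    -- One and the same `t` serves both halves, which lets the direction be chosen afterwards.
    median : (A : VecSet m k) → 0 < count A → (f : Vec (Fin m) k → ℤ) →
             ∃[ t ] count A ≤ 2 * count (atLeast A f t) × count A ≤ 2 * count (atMost A f t)
    median A A>0 f = level s , Ps , +-cancelˡ-≤ (count A) _ _ lower
      where
      M : ℕ
      M = boxSum k (ℤ.∣_∣ ∘ f)
      level : ℕ → ℤ
      level s = + s ℤ.- + M
      U L : ℕ → ℕ
      U s = count (atLeast A f (level s))
      L s = count (atMost A f (level s))
      ∣f∣≤M : ∀ a → ℤ.∣ f a ∣ ≤ M
      ∣f∣≤M = term≤boxSum k (ℤ.∣_∣ ∘ f)
      P0 : count A ≤ 2 * U 0
      P0 = ≤-trans (count-mono {A = A} λ a a∈A → ∧-intro (_ ℤ.≤? f a) a∈A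
             (ℤ.≤-trans (ℤ.≤-reflexive (ℤ.+-identityˡ _))
               (ℤ.≤-trans (ℤ.neg-mono-≤ (ℤ.+≤+ (∣f∣≤M a))) (-∣i∣≤i (f a))))) (m≤m+n _ _)
      M<level : + M ℤ.< level (suc (M + M))
      M<level = ℤ.≤-<-trans (ℤ.≤-reflexive lemma) (ℤ.+-monoˡ-< (ℤ.- + M) (ℤ.+<+ (n<1+n (M + M))))
        where
        lemma : + M ≡ + (M + M) ℤ.- + M
        lemma = sym (trans (cong (ℤ._- + M) (ℤ.pos-+ M M))
                    (trans (ℤ.+-assoc (+ M) (+ M) (ℤ.- + M))
                    (trans (cong (ℤ._+_ (+ M)) (ℤ.+-inverseʳ (+ M))) (ℤ.+-identityʳ (+ M)))))
      ¬Pn : ¬ count A ≤ 2 * U (suc (M + M))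
      ¬Pn A≤ with U (suc (M + M)) in eq
      ... | zero  = <⇒≱ A>0 A≤
      ... | suc _ with count>0⇒∈ (atLeast A f (level (suc (M + M)))) (subst (0 <_) (sym eq) (s≤s z≤n))
      ... | a , a∈ = contradiction
        (ℤ.≤-trans (∧-elimʳ (A a) (_ ℤ.≤? f a) a∈) (ℤ.≤-trans (i≤∣i∣ (f a)) (ℤ.+≤+ (∣f∣≤M a))))
        (ℤ.<⇒≱ M<level)
      cross : ∃[ s ] count A ≤ 2 * U s × ¬ count A ≤ 2 * U (suc s)
      cross = crossing (λ s → count A ≤? 2 * U s) P0 (suc (M + M)) ¬Pn
      s : ℕ
      s = proj₁ cross
      Ps : count A ≤ 2 * U s
      Ps = proj₁ (proj₂ cross)
      level-suc : level (suc s) ≡ ℤ.suc (level s)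
      level-suc = ℤ.suc-+ s (ℤ.- + M)
      cover : ∀ a → a ∈ˢ A → a ∈ˢ atLeast A f (level (suc s)) ⊎ a ∈ˢ atMost A f (level s)
      cover a a∈A = case f a ℤ.≤? level s of λ where
        (yes fa≤) → inj₂ (∧-intro (f a ℤ.≤? _) a∈A fa≤)
        (no fa≰)  → inj₁ (∧-intro (_ ℤ.≤? f a) a∈A
                            (subst (ℤ._≤ f a) (sym level-suc) (ℤ.i<j⇒suc[i]≤j (ℤ.≰⇒> fa≰))))
      lower : count A + count A ≤ count A + 2 * L s
      lower = begin
        count A + count A                  ≡⟨ cong (_+_ (count A)) (+-identityʳ _) ⟨
        2 * count A                        ≤⟨ *-monoʳ-≤ 2 (count-∪ {A = A} cover) ⟩
        2 * (U (suc s) + L s)              ≡⟨ *-distribˡ-+ 2 (U (suc s)) (L s) ⟩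
        2 * U (suc s) + 2 * L s            ≤⟨ +-monoˡ-≤ (2 * L s) (<⇒≤ (≰⇒> (proj₂ (proj₂ cross)))) ⟩
        count A + 2 * L s                  ∎
        where open ≤-Reasoning

-- Thick sets

-- The total gain from `f` to `g` is at least the gain at the single index `i`, written without
-- subtraction.
sum-swap : ∀ {n} (f g : Fin n → ℕ) → (∀ i → f i ≤ g i) → ∀ i → sum f + g i ≤ sum g + f i
sum-swap {suc n} f g f≤g zero    = begin
  f zero + sum (f ∘ suc) + g zero   ≡⟨ reorder (f zero) _ (g zero) ⟩
  g zero + sum (f ∘ suc) + f zero   ≤⟨ +-monoˡ-≤ (f zero) (+-monoʳ-≤ (g zero) (sum-mono (f≤g ∘ suc))) ⟩
  g zero + sum (g ∘ suc) + f zero   ∎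
  where
  open ≤-Reasoning
  reorder : ∀ x y z → x + y + z ≡ z + y + x
  reorder = solve-∀
sum-swap {suc n} f g f≤g (suc i) = begin
  f zero + sum (f ∘ suc) + g (suc i)    ≡⟨ +-assoc (f zero) _ _ ⟩
  f zero + (sum (f ∘ suc) + g (suc i))  ≤⟨ +-mono-≤ (f≤g zero) (sum-swap (f ∘ suc) (g ∘ suc) (f≤g ∘ suc) i) ⟩
  g zero + (sum (g ∘ suc) + f (suc i))  ≡⟨ +-assoc (g zero) _ _ ⟨
  g zero + sum (g ∘ suc) + f (suc i)    ∎
  where open ≤-Reasoning

module _ {m k : ℕ} where

  deg : VecSet m (suc k) → Fin (suc k) → Vec (Fin m) k → ℕ
  deg A i a = sum λ j → ⟦ A (insertAt a i j) ⟧

  shadow? : (A : VecSet m (suc k)) (i : Fin (suc k)) (a : Vec (Fin m) k) →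
            Dec (∃[ j ] insertAt a i j ∈ˢ A)
  shadow? A i a = Fin.any? λ j → A (insertAt a i j) Bool.≟ true

  shadow : VecSet m (suc k) → Fin (suc k) → VecSet m k
  shadow A i = does ∘ shadow? A i

  shadow⇒∃ : ∀ A i a → a ∈ˢ shadow A i → ∃[ j ] insertAt a i j ∈ˢ A
  shadow⇒∃ A i a a∈ with yes p ← shadow? A i a = p

  count-deg : ∀ A i → count A ≡ boxSum k (deg A i)
  count-deg A i = boxSum-insertAt k i (⟦_⟧ ∘ A)

  shadow-mono : ∀ {A B} → (∀ a → a ∈ˢ A → a ∈ˢ B) → ∀ i a → a ∈ˢ shadow A i → a ∈ˢ shadow B i
  shadow-mono {A} {B} A⊆B i a a∈ with j , p ← shadow⇒∃ A i a a∈ =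
    dec-true (shadow? B i a) (j , A⊆B _ p)

  Thick : ℕ → VecSet m (suc k) → Set
  Thick D A = ∀ i a j → insertAt a i j ∈ˢ A → D ≤ deg A i a

  erase : VecSet m (suc k) → Fin (suc k) → Vec (Fin m) k → VecSet m (suc k)
  erase A i a b = A b ∧ does (¬? (≡-dec Fin._≟_ (removeAt b i) a))

  module _ (A : VecSet m (suc k)) (i : Fin (suc k)) (a : Vec (Fin m) k) where

    erase⊆ : ∀ b → b ∈ˢ erase A i a → b ∈ˢ A
    erase⊆ b = ∧-elimˡ (A b)

    ∉erase : ∀ j → ¬ insertAt a i j ∈ˢ erase A i a
    ∉erase j p = ∧-elimʳ (A (insertAt a i j)) (¬? (≡-dec Fin._≟_ _ a)) p (removeAt-insertAt a i j)

    erase-other : ∀ {b} → b ≢ a → ∀ j → insertAt b i j ∈ˢ A → insertAt b i j ∈ˢ erase A i a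
    erase-other {b} b≢a j p =
      ∧-intro (¬? (≡-dec Fin._≟_ _ a)) p (b≢a ∘ trans (sym (removeAt-insertAt b i j)))

    -- Compare fibre by fibre. Away from `a` nothing leaves `A`. Over `a` the left side counts fewer
    -- than `D` points and an empty shadow, the right side no points and a full `D` for the shadow.
    erase-potential : ∀ D → a ∈ˢ shadow A i → deg A i a < D →
      count A + D * count (shadow (erase A i a) i) ≤ count (erase A i a) + D * count (shadow A i)
    erase-potential D a∈ deg<D = begin
      count A + D * count (shadow A′ i)
        ≡⟨ split A (shadow A′ i) ⟨
      boxSum k (λ b → deg A i b + D * ⟦ shadow A′ i b ⟧)
        ≤⟨ boxSum-mono k (λ b → pointwise b (≡-dec Fin._≟_ b a)) ⟩
      boxSum k (λ b → deg A′ i b + D * ⟦ shadow A i b ⟧)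
        ≡⟨ split A′ (shadow A i) ⟩
      count A′ + D * count (shadow A i)
        ∎
      where
      open ≤-Reasoning
      A′ : VecSet m (suc k)
      A′ = erase A i a
      split : ∀ B S → boxSum k (λ b → deg B i b + D * ⟦ S b ⟧) ≡ count B + D * count S
      split B S = trans (boxSum-+ k (deg B i) _)
                        (cong₂ _+_ (sym (count-deg B i)) (boxSum-* k D (⟦_⟧ ∘ S)))
      pointwise : ∀ b → Dec (b ≡ a) →
                  deg A i b + D * ⟦ shadow A′ i b ⟧ ≤ deg A′ i b + D * ⟦ shadow A i b ⟧
      pointwise b (no b≢a)  = +-mono-≤ (sum-mono λ j → ⟦⟧-mono (erase-other b≢a j))
                                       (*-monoʳ-≤ D (⟦⟧-mono (shadow-mono erase⊆ i b)))
      pointwise b (yes refl)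
        rewrite a∈ | dec-false (shadow? A′ i a) (λ (j , p) → ∉erase j p) | *-zeroʳ D | *-identityʳ D
              | +-identityʳ (deg A i a)
        = ≤-trans (<⇒≤ deg<D) (m≤n+m D _)

  opaque
    -- Erasing a fibre with fewer than D elements in direction i lowers count A by less than
    -- D and the i-th shadow by one, so count A - D ∑ᵢ count (shadow A i) never decreases.
    prune : ∀ D (A : VecSet m (suc k)) → ∃[ A′ ]
      (∀ a → a ∈ˢ A′ → a ∈ˢ A) × Thick D A′ ×
      count A + D * sum (count ∘ shadow A′) ≤ count A′ + D * sum (count ∘ shadow A)
    prune D A = go A (<-wellFounded (count A))
      where
      low? : ∀ A → Dec (∃[ i ] ∃[ a ] a ∈ˢ shadow A i × deg A i a < D)
      low? A = Fin.any? λ i → search k λ a → (shadow A i a Bool.≟ true) ×-dec (deg A i a <? D)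
      go : ∀ A → Acc _<_ (count A) → ∃[ A′ ]
        (∀ a → a ∈ˢ A′ → a ∈ˢ A) × Thick D A′ ×
        count A + D * sum (count ∘ shadow A′) ≤ count A′ + D * sum (count ∘ shadow A)
      go A (acc rec) with low? A
      ... | no ¬low = A , (λ _ p → p) , (λ i a j p → ≮⇒≥ λ deg<D →
                        ¬low (i , a , dec-true (shadow? A i a) (j , p) , deg<D)) , ≤-refl
      ... | yes (i , a , a∈ , deg<D)
        with j , p ← shadow⇒∃ A i a a∈
        with A″ , A″⊆ , thick , Φ ← go (erase A i a)
               (rec (count-strict {A = erase A i a} {B = A} (erase⊆ A i a) _ p (∉erase A i a j)))
        = A″ , (λ b q → erase⊆ A i a b (A″⊆ b q)) , thick , combine
        where
        open ≤-Reasoning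
        A′ : VecSet m (suc k)
        A′ = erase A i a
        s s′ s″ : ℕ
        s  = sum (count ∘ shadow A)
        s′ = sum (count ∘ shadow A′)
        s″ = sum (count ∘ shadow A″)
        x y : ℕ
        x = count (shadow A i)
        y = count (shadow A′ i)
        swap : s′ + x ≤ s + y
        swap = sum-swap (count ∘ shadow A′) (count ∘ shadow A)
                 (λ i′ → count-mono {A = shadow A′ i′} (shadow-mono (erase⊆ A i a) i′)) i
        arrange₁ : ∀ D c′ x c″ s′ → (c′ + D * x) + (c″ + D * s′) ≡ D * (s′ + x) + (c″ + c′)
        arrange₁ = solve-∀
        arrange₂ : ∀ D c′ s c″ y → D * (s + y) + (c″ + c′) ≡ c″ + D * s + (c′ + D * y)
        arrange₂ = solve-∀
        arrange₃ : ∀ c D y c′ s″ → c + D * s″ + (c′ + D * y) ≡ (c + D * y) + (c′ + D * s″)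
        arrange₃ = solve-∀
        -- `swap` says that the shadows shrink in total by at least `x - y`, the loss in direction
        -- `i` alone; losses in other directions only help.
        combine : count A + D * s″ ≤ count A″ + D * s
        combine = +-cancelʳ-≤ (count A′ + D * y) _ _ (begin
          count A + D * s″ + (count A′ + D * y)       ≡⟨ arrange₃ (count A) D y (count A′) s″ ⟩
          (count A + D * y) + (count A′ + D * s″)     ≤⟨ +-mono-≤ (erase-potential A i a D a∈ deg<D) Φ ⟩
          (count A′ + D * x) + (count A″ + D * s′)    ≡⟨ arrange₁ D (count A′) x (count A″) s′ ⟩
          D * (s′ + x) + (count A″ + count A′)        ≤⟨ +-monoˡ-≤ _ (*-monoʳ-≤ D swap) ⟩
          D * (s + y) + (count A″ + count A′)         ≡⟨ arrange₂ D (count A′) s (count A″) y ⟩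
          count A″ + D * s + (count A′ + D * y)       ∎)

-- Tables hitting a value on every fibre

-- Tables that take the value `b` nowhere on `E`; `E` will be a fibre of `A`, a set of slots.
avoids : ∀ {n m} → (Fin m → Bool) → Fin n → VecSet n m
avoids E b []      = true
avoids E b (c ∷ y) = not (E zero ∧ does (c Fin.≟ b)) ∧ avoids (E ∘ suc) b y

¬avoids⇒hits : ∀ {n m} (E : Fin m → Bool) (b : Fin n) y → ¬ y ∈ˢ avoids E b →
               ∃[ j ] E j ≡ true × lookup y j ≡ b
¬avoids⇒hits E b []      ¬p = contradiction refl ¬p
¬avoids⇒hits E b (c ∷ y) ¬p with E zero in E₀ | c Fin.≟ b
... | true  | yes c≡b = zero , E₀ , c≡b
... | true  | no _    = let j , p = ¬avoids⇒hits (E ∘ suc) b y ¬p in suc j , p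
... | false | _       = let j , p = ¬avoids⇒hits (E ∘ suc) b y ¬p in suc j , p

sum-≢ : ∀ {n} (b : Fin (suc n)) → sum (λ c → ⟦ not (does (c Fin.≟ b)) ⟧) ≡ n
sum-≢ {n}     zero    = trans (sum-const n 1) (*-identityʳ n)
sum-≢ {suc n} (suc b) = cong suc (sum-≢ b)

module _ {n : ℕ} where

  -- Slots in `E` allow `n` of the `suc n` values, the others allow all. The equation is multiplied
  -- out by `suc n ^ sum (⟦_⟧ ∘ E)` so that no exponent is a difference.
  count-avoids : ∀ {m} (E : Fin m → Bool) (b : Fin (suc n)) →
    count (avoids E b) * suc n ^ sum (⟦_⟧ ∘ E) ≡ n ^ sum (⟦_⟧ ∘ E) * suc n ^ m
  count-avoids {zero}  E b = refl
  count-avoids {suc m} E b = trans (cong (_* suc n ^ sum (⟦_⟧ ∘ E)) factor) (head (E zero))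
    where
    c r : ℕ
    c = count (avoids (E ∘ suc) b)
    r = sum (⟦_⟧ ∘ E ∘ suc)
    ⟦∧⟧ : ∀ x y → ⟦ x ∧ y ⟧ ≡ ⟦ x ⟧ * ⟦ y ⟧
    ⟦∧⟧ true  y = sym (+-identityʳ ⟦ y ⟧)
    ⟦∧⟧ false y = refl
    new : Bool → Fin (suc n) → ℕ
    new e c = ⟦ not (e ∧ does (c Fin.≟ b)) ⟧
    factor : count (avoids E b) ≡ c * sum (new (E zero))
    factor = trans (sum-cong-≗ row) (sym (*-distribˡ-sum c (new (E zero))))
      where
      row : ∀ h → boxSum m (λ y → ⟦ avoids E b (h ∷ y) ⟧) ≡ c * new (E zero) h
      row h = trans (boxSum-cong m λ y → ⟦∧⟧ (not (E zero ∧ does (h Fin.≟ b))) (avoids (E ∘ suc) b y))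
             (trans (boxSum-* m (new (E zero) h) (⟦_⟧ ∘ avoids (E ∘ suc) b))
                    (*-comm (new (E zero) h) c))
    regroup₁ : ∀ c n N p → c * n * (N * p) ≡ n * (c * p) * N
    regroup₁ = solve-∀
    regroup₂ : ∀ c N p → c * N * p ≡ N * (c * p)
    regroup₂ = solve-∀
    regroup₃ : ∀ n a N p → n * (a * p) * N ≡ n * a * (N * p)
    regroup₃ = solve-∀
    regroup₄ : ∀ a N p → N * (a * p) ≡ a * (N * p)
    regroup₄ = solve-∀
    head : ∀ e → c * sum (new e) * suc n ^ (⟦ e ⟧ + r) ≡ n ^ (⟦ e ⟧ + r) * (suc n * suc n ^ m)
    head true  = trans (cong (λ s → c * s * suc n ^ suc r) (sum-≢ b))
                (trans (regroup₁ c n (suc n) (suc n ^ r))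
                (trans (cong (λ s → n * s * suc n) (count-avoids (E ∘ suc) b))
                       (regroup₃ n (n ^ r) (suc n) (suc n ^ m))))
    head false = trans (cong (λ s → c * s * suc n ^ r) (trans (sum-const (suc n) 1) (*-identityʳ (suc n))))
                (trans (regroup₂ c (suc n) (suc n ^ r))
                (trans (cong (suc n *_) (count-avoids (E ∘ suc) b))
                       (regroup₄ (n ^ r) (suc n) (suc n ^ m))))

  -- Each of the `d` slots beyond the first `D` contributes a factor `n / suc n`, at most 1.
  count-avoids-≤ : ∀ {m} (E : Fin m → Bool) b D → D ≤ sum (⟦_⟧ ∘ E) →
                   count (avoids E b) * suc n ^ D ≤ n ^ D * suc n ^ m
  count-avoids-≤ {m} E b D D≤ with d , eq ← m≤n⇒∃[o]m+o≡n D≤ = *-cancelʳ-≤ _ _ (suc n ^ d) {{m^n≢0 (suc n) d}} (begin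
    C * suc n ^ D * suc n ^ d     ≡⟨ *-assoc C _ _ ⟩
    C * (suc n ^ D * suc n ^ d)   ≡⟨ cong (C *_) (^-distribˡ-+-* (suc n) D d) ⟨
    C * suc n ^ (D + d)           ≡⟨ cong (λ e → C * suc n ^ e) eq ⟩
    C * suc n ^ e                 ≡⟨ count-avoids E b ⟩
    n ^ e * suc n ^ m             ≡⟨ cong (λ e → n ^ e * suc n ^ m) eq ⟨
    n ^ (D + d) * suc n ^ m       ≡⟨ cong (_* suc n ^ m) (^-distribˡ-+-* n D d) ⟩
    n ^ D * n ^ d * suc n ^ m     ≤⟨ *-monoˡ-≤ _ (*-monoʳ-≤ (n ^ D) (^-monoˡ-≤ d (n≤1+n n))) ⟩
    n ^ D * suc n ^ d * suc n ^ m ≡⟨ regroup (n ^ D) (suc n ^ d) (suc n ^ m) ⟩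
    n ^ D * suc n ^ m * suc n ^ d ∎)
    where
    open ≤-Reasoning
    C e : ℕ
    C = count (avoids E b)
    e = sum (⟦_⟧ ∘ E)
    regroup : ∀ x y z → x * y * z ≡ x * z * y
    regroup = solve-∀

  opaque
    -- Union bound over the fibres: a fixed fibre of at least D pointers misses the value b
    -- for at most a fraction (n / (n + 1)) ^ D of all y.
    hitting : ∀ {m k} D (A : VecSet m (suc k)) → Thick D A → ∀ i (B : VecSet (suc n) m) b →
      m ^ k * (n ^ D * suc n ^ m) < count B * suc n ^ D →
      ∃[ y ] y ∈ˢ B × (∀ a → a ∈ˢ shadow A i → ∃[ j ] insertAt a i j ∈ˢ A × lookup y j ≡ b)
    hitting {m} {k} D A thick i B b large with search m hit?
      where
      missed? : ∀ y → Dec (∃[ a ] shadow A i a ∧ avoids (λ j → A (insertAt a i j)) b y ≡ true)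
      missed? y = search k λ a → _ Bool.≟ true
      hit? : ∀ y → Dec (y ∈ˢ B × ¬ (∃[ a ] shadow A i a ∧ avoids (λ j → A (insertAt a i j)) b y ≡ true))
      hit? y = (B y Bool.≟ true) ×-dec ¬? (missed? y)
    ... | yes (y , y∈B , hit) = y , y∈B , λ a a∈ →
          ¬avoids⇒hits _ b y λ p → hit (a , trans (cong₂ _∧_ a∈ p) refl)
    ... | no ∄y = contradiction missed-everywhere (<⇒≱ large)
      where
      open ≤-Reasoning
      fibre : Vec (Fin m) k → Fin m → Bool
      fibre a j = A (insertAt a i j)
      missed : Vec (Fin (suc n)) m → Vec (Fin m) k → ℕ
      missed y a = ⟦ shadow A i a ∧ avoids (fibre a) b y ⟧
      -- If no table hits every fibre, each table of `B` is charged to a fibre that it misses.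
      covered : ∀ y → ⟦ B y ⟧ ≤ boxSum k (missed y)
      covered y with B y in y∈B
      ... | false = z≤n
      ... | true with search k (λ a → shadow A i a ∧ avoids (fibre a) b y Bool.≟ true)
      ...   | yes (a , p) = subst (λ x → ⟦ x ⟧ ≤ boxSum k (missed y)) p (term≤boxSum k (missed y) a)
      ...   | no ¬p       = contradiction (y , y∈B , ¬p) ∄y
      single : ∀ a → suc n ^ D * boxSum m (λ y → missed y a) ≤ n ^ D * suc n ^ m
      single a with shadow? A i a
      ... | no _ = ≤-trans (≤-reflexive (trans (cong (suc n ^ D *_) (trans (boxSum-const m 0) (*-zeroʳ (suc n ^ m)))) (*-zeroʳ (suc n ^ D)))) z≤n
      ... | yes (j , p) = ≤-trans (≤-reflexive (*-comm (suc n ^ D) _))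
                                  (count-avoids-≤ (fibre a) b D (thick i a j p))
      missed-everywhere : count B * suc n ^ D ≤ m ^ k * (n ^ D * suc n ^ m)
      missed-everywhere = begin
        count B * suc n ^ D
          ≡⟨ *-comm (count B) _ ⟩
        suc n ^ D * count B
          ≤⟨ *-monoʳ-≤ (suc n ^ D) (boxSum-mono m covered) ⟩
        suc n ^ D * boxSum m (λ y → boxSum k (missed y))
          ≡⟨ cong (suc n ^ D *_) (boxSum-comm m k missed) ⟩
        suc n ^ D * boxSum k (λ a → boxSum m (λ y → missed y a))
          ≡⟨ boxSum-* k (suc n ^ D) _ ⟨
        boxSum k (λ a → suc n ^ D * boxSum m (λ y → missed y a))
          ≤⟨ boxSum-mono k single ⟩
        boxSum {m} k (const (n ^ D * suc n ^ m))
          ≡⟨ boxSum-const k _ ⟩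
        m ^ k * (n ^ D * suc n ^ m)
          ∎

-- The adversary

insertAt-comm : ∀ {a} {X : Set a} {k} (i : Fin (suc (suc k))) (l : Fin (suc k)) → ∃[ i′ ] ∃[ l′ ]
                (∀ (v : Vec X k) x y → insertAt (insertAt v l x) i y ≡ insertAt (insertAt v l′ y) i′ x)
insertAt-comm zero    l    = suc l , zero , λ v x y → refl
insertAt-comm (suc i) zero = zero , i , λ v x y → refl
insertAt-comm {k = suc k} (suc i) (suc l) with i′ , l′ , eq ← insertAt-comm i l =
  suc i′ , suc l′ , λ { (z ∷ v) x y → cong (z ∷_) (eq v x y) }

-- Lift a point of the shadow to a point of `A` with some entry `y` in coordinate `i`. The fibre of
-- `A` through it in direction `l′` keeps this `y`, so it projects injectively into the fibre of the
-- shadow.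
Thick-shadow : ∀ {m k D} (A : VecSet m (suc (suc k))) → Thick D A → ∀ i → Thick D (shadow A i)
Thick-shadow {D = D} A thick i l a x a∈
  with y , p ← shadow⇒∃ A i _ a∈
  with i′ , l′ , comm ← insertAt-comm i l
  = ≤-trans (thick i′ (insertAt a l′ y) x (subst (_∈ˢ A) (comm a x y) p))
      (sum-mono λ z → ⟦⟧-mono λ q → dec-true (shadow? A i _) (y , subst (_∈ˢ A) (sym (comm a z y)) q))

-- `m-large` pays for projections, `2≤D` keeps the pointers of free nodes from being constant, and
-- `union` is the union bound over at most `m ^ N` fibres for sets of tables of density at least
-- `1 / 2 ^ N`.
record Parameters (n m D : ℕ) : Set where
  field
    m-large : 16 * (suc n * D) ≤ m
    2≤D     : 2 ≤ D
    union   : m ^ suc n * n ^ D * 2 ^ suc n < suc n ^ D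

module Adversary {n m D : ℕ} {{_ : NonZero m}} (parameters : Parameters n m D) where

  open Parameters parameters

  N : ℕ
  N = suc n

  Point : Set
  Point = Vec (Fin m) N × (Fin N → Vec (Fin N) m)

  Fixed : (Point → Set) → Fin N → Fin N → Set
  Fixed P i b = ∀ {p} → P p → lookup (proj₂ p i) (lookup (proj₁ p) i) ≡ b

  -- The invariant behind the move clauses. A `stopped` node does not go up and is not node 0, so no
  -- move clause starts from it. A `moved` node goes up, and its target is either the lowest free
  -- node, the current end of the path, or again a node that goes up.
  data Status (P : Point → Set) {k} (names : Fin (suc k) → Fin N) (i : Fin N) : Set where
    free    : ∀ l → names l ≡ i → Status P names i
    stopped : ∀ {b} → Fixed P i b → b Fin.≤ i → zero {n} Fin.< i → Status P names i
    moved   : ∀ {b} → Fixed P i b → i Fin.< b →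
              b ≡ names zero ⊎ (∃[ c ] Fixed P b c × b Fin.< c) → Status P names i

  module _ {k : ℕ} (A : VecSet m (suc k)) (ext : Vec (Fin m) (suc k) → Vec (Fin m) N)
           (B : Fin N → VecSet N m) where
    Box : Point → Set
    Box (x , ys) = (∃[ a ] a ∈ˢ A × ext a ≡ x) × (∀ i → ys i ∈ˢ B i)

  -- After t branchings, suc k nodes are still free; A is indexed by these alone, and ext supplies the
  -- pointers of the nodes given up.  A-dense says that A has density at least 4 ^ (N ∸ suc k) / 4 ^ t.
  record State (t k : ℕ) : Set where
    field
      A          : VecSet m (suc k)
      names      : Fin (suc k) → Fin N
      ext        : Vec (Fin m) (suc k) → Vec (Fin m) N
      B          : Fin N → VecSet N m
    points : Point → Set
    points = Box A ext B
    field
      k<N        : k < N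
      names-mono : ∀ {i j} → i Fin.< j → names i Fin.< names j
      ext-free   : ∀ a l → lookup (ext a) (names l) ≡ lookup a l
      thick      : Thick D A
      A-dense    : m ^ suc k * 4 ^ N ≤ count A * 4 ^ t * 4 ^ suc k
      B-nonempty : ∀ i → 0 < count (B i)
      B-dense    : ∀ l → N ^ m ≤ count (B (names l)) * 2 ^ t
      status     : ∀ i → Status points names i

  open State

  _⊑_ : ∀ {t k u l} → State t k → State u l → Set
  s ⊑ s′ = ∀ {p} → points s p → points s′ p

  Status-mono : ∀ {P Q : Point → Set} {k} {names : Fin (suc k) → Fin N} →
                (∀ {p} → Q p → P p) → ∀ {i} → Status P names i → Status Q names i
  Status-mono Q⊆P (free l eq)         = free l eq
  Status-mono Q⊆P (stopped f b≤i 0<i) = stopped (f ∘ Q⊆P) b≤i 0<i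
  Status-mono Q⊆P (moved f i<b (inj₁ eq))            = moved (f ∘ Q⊆P) i<b (inj₁ eq)
  Status-mono Q⊆P (moved f i<b (inj₂ (c , g , b<c))) = moved (f ∘ Q⊆P) i<b (inj₂ (c , g ∘ Q⊆P , b<c))

  A-nonempty : ∀ {t k} (s : State t k) → 0 < count (A s)
  A-nonempty {t} {k} s with count (A s) in eq
  ... | suc _ = s≤s z≤n
  ... | zero  = contradiction
    (subst (λ c → m ^ suc k * 4 ^ N ≤ c * 4 ^ t * 4 ^ suc k) eq (A-dense s))
    (<⇒≱ (*-mono-< (m^n>0 m (suc k)) (m^n>0 4 N)))

  inhabited : ∀ {t k} (s : State t k) → ∃[ p ] points s p
  inhabited s = let a , a∈ = count>0⇒∈ (A s) (A-nonempty s)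
                    y      = λ i → count>0⇒∈ (B s i) (B-nonempty s i)
                in (ext s a , proj₁ ∘ y) , (a , a∈ , refl) , proj₂ ∘ y

  -- A density is at most 1, so `A-dense` limits the nodes given up to one per branching.
  dimension : ∀ {t k} → State t k → N ≤ t + suc k
  dimension {t} {k} s = ≮⇒≥ λ t+k<N → contradiction
    (*-cancelˡ-≤ (m ^ suc k) {{m^n≢0 m (suc k)}} (≤-trans (A-dense s) (begin
      count (A s) * 4 ^ t * 4 ^ suc k   ≡⟨ *-assoc (count (A s)) _ _ ⟩
      count (A s) * (4 ^ t * 4 ^ suc k) ≤⟨ *-monoˡ-≤ _ (count≤ (A s)) ⟩
      m ^ suc k * (4 ^ t * 4 ^ suc k)   ≡⟨ cong (m ^ suc k *_) (^-distribˡ-+-* 4 t (suc k)) ⟨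
      m ^ suc k * 4 ^ (t + suc k)       ∎)))
    (<⇒≱ (^-monoʳ-< 4 (s≤s (s≤s z≤n)) t+k<N))
    where open ≤-Reasoning

  initial : State 0 n
  initial = record
    { A          = const true
    ; names      = id
    ; ext        = id
    ; B          = const (const true)
    ; k<N        = ≤-refl
    ; names-mono = id
    ; ext-free   = λ _ _ → refl
    ; thick      = λ _ _ _ _ → ≤-trans D≤m (≤-reflexive (sym (trans (sum-const m 1) (*-identityʳ m))))
    ; A-dense    = ≤-reflexive (cong (_* 4 ^ N) (sym (trans (*-identityʳ _) (full m N))))
    ; B-nonempty = λ _ → subst (0 <_) (sym (full N m)) (m^n>0 N m)
    ; B-dense    = λ _ → ≤-reflexive (sym (trans (*-identityʳ _) (full N m)))
    ; status     = λ i → free i refl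
    }
    where
    full : ∀ q k → count {q} {k} (const true) ≡ q ^ k
    full q k = trans (boxSum-const k 1) (*-identityʳ _)
    D≤m : D ≤ m
    D≤m = ≤-trans (m≤n*m D (16 * N)) (≤-trans (≤-reflexive (*-assoc 16 N D)) m-large)

  -- Giving up a node

  module Query {t k} (s : State t (suc k)) (t≤N : t ≤ N) (i : Fin (suc (suc k))) where

    -- Arguments are positions among the free nodes in increasing order. Position `zero` is the end
    -- of the path, which must go up, to the next free node; all later positions name nonzero nodes
    -- and may safely fall back to node 0.
    answer : Fin (suc (suc k)) → Fin N
    answer zero    = names s (suc zero)
    answer (suc _) = zero

    room : m ^ suc k * (n ^ D * N ^ m) < count (B s (names s i)) * N ^ D
    room = begin-strict
      m ^ suc k * (n ^ D * N ^ m)           ≤⟨ *-monoʳ-≤ (m ^ suc k) (*-monoʳ-≤ (n ^ D) (B-dense s i)) ⟩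
      m ^ suc k * (n ^ D * (b * 2 ^ t))     ≡⟨ regroup (m ^ suc k) (n ^ D) b (2 ^ t) ⟩
      b * (m ^ suc k * n ^ D * 2 ^ t)       ≤⟨ *-monoʳ-≤ b (*-mono-≤ (*-monoˡ-≤ (n ^ D) (^-monoʳ-≤ m (<⇒≤ (k<N s)))) (^-monoʳ-≤ 2 t≤N)) ⟩
      b * (m ^ N * n ^ D * 2 ^ N)           <⟨ *-monoʳ-< b {{>-nonZero (B-nonempty s (names s i))}} union ⟩
      b * N ^ D                             ∎
      where
      open ≤-Reasoning
      b : ℕ
      b = count (B s (names s i))
      regroup : ∀ p q b u → p * (q * (b * u)) ≡ b * (p * q * u)
      regroup = solve-∀

    opaque
      hit : ∃[ y ] y ∈ˢ B s (names s i) ×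
            (∀ a → a ∈ˢ shadow (A s) i → ∃[ j ] insertAt a i j ∈ˢ A s × lookup y j ≡ answer i)
      hit = hitting D (A s) (thick s) i (B s (names s i)) (answer i) room

    y* : Vec (Fin N) m
    y* = proj₁ hit

    names′ : Fin (suc k) → Fin N
    names′ = names s ∘ punchIn i

    ext? : ∀ a → Dec (∃[ j ] insertAt a i j ∈ˢ A s × lookup y* j ≡ answer i)
    ext? a = Fin.any? λ j → (A s (insertAt a i j) Bool.≟ true) ×-dec (lookup y* j Fin.≟ answer i)

    pointer : Vec (Fin m) (suc k) → Fin m
    pointer a with ext? a
    ... | yes (j , _) = j
    -- An arbitrary slot: the points of the new box lie over the shadow, where the other case
    -- applies.
    ... | no  _       = Fin.fromℕ< {0} (>-nonZero⁻¹ m)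

    pointer-spec : ∀ a → a ∈ˢ shadow (A s) i →
                   insertAt a i (pointer a) ∈ˢ A s × lookup y* (pointer a) ≡ answer i
    pointer-spec a a∈ with ext? a
    ... | yes (_ , p) = p
    ... | no ¬p       = contradiction (proj₂ (proj₂ hit) a a∈) ¬p

    ext′ : Vec (Fin m) (suc k) → Vec (Fin m) N
    ext′ a = ext s (insertAt a i (pointer a))

    -- The table of the node given up becomes the single `y*`. Its density is lost, which is why
    -- `B-dense` speaks of free nodes only; nonemptiness is all that later halvings need there.
    B′ : Fin N → VecSet N m
    B′ v y = if does (v Fin.≟ names s i) then does (≡-dec Fin._≟_ y y*) else B s v y

    B′-at : ∀ y → y ∈ˢ B′ (names s i) → y ≡ y*
    B′-at y p with names s i Fin.≟ names s i
    ... | no ¬refl = contradiction refl ¬refl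
    ... | yes _    with yes eq ← ≡-dec Fin._≟_ y y* = eq

    B′⊆B : ∀ v y → y ∈ˢ B′ v → y ∈ˢ B s v
    B′⊆B v y p with v Fin.≟ names s i
    ... | no _     = p
    ... | yes refl with yes refl ← ≡-dec Fin._≟_ y y* = proj₁ (proj₂ hit)

    B′-elsewhere : ∀ {v} → v ≢ names s i → count (B′ v) ≡ count (B s v)
    B′-elsewhere {v} v≢ rewrite dec-false (v Fin.≟ names s i) v≢ = refl

    B′-nonempty : ∀ v → 0 < count (B′ v)
    B′-nonempty v with v Fin.≟ names s i
    ... | no _  = B-nonempty s v
    ... | yes _ = ∈⇒count>0 (λ y → does (≡-dec Fin._≟_ y y*)) y* (dec-true (≡-dec Fin._≟_ y* y*) refl)

    points′ : Point → Set
    points′ = Box (shadow (A s) i) ext′ B′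

    points′⊆ : ∀ {p} → points′ p → points s p
    points′⊆ ((a , a∈ , refl) , ys∈) =
      (insertAt a i (pointer a) , proj₁ (pointer-spec a a∈) , refl) , λ v → B′⊆B v _ (ys∈ v)

    answered : Fixed points′ (names s i) (answer i)
    answered {_ , ys} ((a , a∈ , refl) , ys∈) =
      trans (cong₂ lookup (B′-at _ (ys∈ (names s i)))
                          (trans (ext-free s _ i) (insertAt-lookup a i _)))
            (proj₂ (pointer-spec a a∈))

    names-injective : ∀ {l l′} → names s l ≡ names s l′ → l ≡ l′
    names-injective {l} {l′} eq with Fin.<-cmp l l′
    ... | tri< l<l′ _ _ = contradiction (cong toℕ eq) (<⇒≢ (names-mono s l<l′))
    ... | tri≈ _ l≡l′ _ = l≡l′
    ... | tri> _ _ l′<l = contradiction (cong toℕ (sym eq)) (<⇒≢ (names-mono s l′<l))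

    -- Only the node at position `zero` can be the target of an open `moved`. When it is given up,
    -- its own answer is a larger node and closes that case; when another node is given up,
    -- `punchIn` leaves position `zero` in place.
    newStatus : ∀ v → Status (points s) (names s) v → Status points′ names′ v
    newStatus v (free l refl) with i Fin.≟ l
    ... | no i≢l   = free (punchOut i≢l) (cong (names s) (Fin.punchIn-punchOut i≢l))
    ... | yes refl = asked i refl
      where
      asked : ∀ l → l ≡ i → Status points′ names′ (names s l)
      asked zero    refl = moved answered (names-mono s (s≤s z≤n)) (inj₁ refl)
      asked (suc l) refl = stopped answered z≤n (≤-<-trans z≤n (names-mono s {zero} (s≤s z≤n)))
    newStatus v (stopped f b≤v 0<v) = stopped (f ∘ points′⊆) b≤v 0<v
    newStatus v (moved f v<b (inj₂ (c , g , b<c))) =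
      moved (f ∘ points′⊆) v<b (inj₂ (c , g ∘ points′⊆ , b<c))
    newStatus v (moved f v<b (inj₁ refl)) = moved (f ∘ points′⊆) v<b (target i refl)
      where
      target : ∀ l → l ≡ i → names s zero ≡ names′ zero ⊎
               (∃[ c ] Fixed points′ (names s zero) c × names s zero Fin.< c)
      target zero    refl = inj₂ (_ , answered , names-mono s (s≤s z≤n))
      target (suc l) refl = inj₁ refl

    -- The ambient cube shrinks by `m`, the set by less than `4 * (N * D)`, which is at most
    -- `m / 4`. The gain of 4 matches the factor lost when `4 ^ suc (suc k)` becomes `4 ^ suc k`.
    A′-dense : count (A s) < 4 * (N * D) * count (shadow (A s) i) →
               m ^ suc k * 4 ^ N ≤ count (shadow (A s) i) * 4 ^ t * 4 ^ suc k
    A′-dense narrow = *-cancelˡ-≤ m (begin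
      m * (m ^ suc k * 4 ^ N)                     ≡⟨ *-assoc m _ _ ⟨
      m ^ suc (suc k) * 4 ^ N                     ≤⟨ A-dense s ⟩
      count (A s) * 4 ^ t * 4 ^ suc (suc k)       ≡⟨ regroup (count (A s)) (4 ^ t) (4 ^ suc k) ⟩
      4 * count (A s) * (4 ^ t * 4 ^ suc k)       ≤⟨ *-monoˡ-≤ _ (*-monoʳ-≤ 4 (<⇒≤ narrow)) ⟩
      4 * (4 * (N * D) * c) * (4 ^ t * 4 ^ suc k) ≡⟨ cong (_* (4 ^ t * 4 ^ suc k)) (regroup₁ (N * D) c) ⟩
      16 * (N * D) * c * (4 ^ t * 4 ^ suc k)      ≤⟨ *-monoˡ-≤ _ (*-monoˡ-≤ c m-large) ⟩
      m * c * (4 ^ t * 4 ^ suc k)                 ≡⟨ regroup₂ m c (4 ^ t) (4 ^ suc k) ⟩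
      m * (c * 4 ^ t * 4 ^ suc k)                 ∎)
      where
      open ≤-Reasoning
      c : ℕ
      c = count (shadow (A s) i)
      regroup : ∀ a u v → a * u * (4 * v) ≡ 4 * a * (u * v)
      regroup = solve-∀
      regroup₁ : ∀ p c → 4 * (4 * p * c) ≡ 16 * p * c
      regroup₁ = solve-∀
      regroup₂ : ∀ m c u v → m * c * (u * v) ≡ m * (c * u * v)
      regroup₂ = solve-∀

    queried : count (A s) < 4 * (N * D) * count (shadow (A s) i) → State t k
    queried narrow = record
      { A          = shadow (A s) i
      ; names      = names′
      ; ext        = ext′
      ; B          = B′
      ; k<N        = <⇒≤ (k<N s)
      ; names-mono = λ l<l′ → names-mono s (Fin.≤∧≢⇒< (Fin.punchIn-mono-≤ i _ _ (<⇒≤ l<l′))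
                       λ eq → <⇒≢ l<l′ (cong toℕ (Fin.punchIn-injective i _ _ eq)))
      ; ext-free   = λ a l → trans (ext-free s _ (punchIn i l)) (insertAt-punchIn a i _ l)
      ; thick      = Thick-shadow (A s) (thick s) i
      ; A-dense    = A′-dense narrow
      ; B-nonempty = B′-nonempty
      ; B-dense    = λ l → subst (λ c → N ^ m ≤ c * 2 ^ t)
                       (sym (B′-elsewhere λ eq → Fin.punchInᵢ≢i i l (names-injective eq)))
                       (B-dense s (punchIn i l))
      ; status     = λ v → newStatus v (status s v)
      }

  -- Deciding a branching

  Saturated : ∀ {t k} → State t k → Set
  Saturated s = ∀ i → 4 * (N * D) * count (shadow (A s) i) ≤ count (A s)

  -- Giving up nodes uses no branchings, so `t` stays fixed while the number of free nodes falls. By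
  -- `dimension` at least two remain as long as `t + 2 ≤ N`, so there is always a next free node to
  -- answer with.
  saturate : ∀ {t} k (s : State t k) → t + 2 ≤ N →
             ∃[ l ] Σ[ s′ ∈ State t l ] Saturated s′ × s′ ⊑ s
  saturate {t} zero s t+2≤N =
    contradiction (≤-trans t+2≤N (dimension s)) (<⇒≱ (+-monoʳ-< t (s≤s (s≤s z≤n))))
  saturate {t} (suc k) s t+2≤N
    with Fin.all? (λ i → 4 * (N * D) * count (shadow (A s) i) ≤? count (A s))
  ... | yes sat = suc k , s , sat , id
  ... | no ¬sat
    with i , ¬wide ← Fin.¬∀⟶∃¬ _ _ (λ i → 4 * (N * D) * count (shadow (A s) i) ≤? count (A s)) ¬sat
    with l , s′ , sat , s′⊑ ← saturate k (Query.queried s (m+n≤o⇒m≤o t t+2≤N) i (≰⇒> ¬wide)) t+2≤N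
    = l , s′ , sat , λ p → Query.points′⊆ s (m+n≤o⇒m≤o t t+2≤N) i (s′⊑ p)

  -- Each shadow of `A₁` lies in one of `A s`, so saturation bounds `D` times the sum of at most `N`
  -- shadows by half of `count A₁`. The potential inequality of `prune` then loses at most half of
  -- `A₁`, and thickness is restored at a total cost of a factor 4.
  restrict : ∀ {t k} (s : State t k) → Saturated s →
    (A₁ : VecSet m (suc k)) → (∀ a → a ∈ˢ A₁ → a ∈ˢ A s) → count (A s) ≤ 2 * count A₁ →
    (B₁ : Fin N → VecSet N m) → (∀ i y → y ∈ˢ B₁ i → y ∈ˢ B s i) →
    (∀ i → count (B s i) ≤ 2 * count (B₁ i)) →
    Σ[ s′ ∈ State (suc t) k ] (∀ {p} → points s′ p → Box A₁ (ext s) B₁ p)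
  restrict {t} {k} s sat A₁ A₁⊆ A₁-half B₁ B₁⊆ B₁-half with A₂ , A₂⊆ , thick₂ , Φ ← prune D A₁ =
    record
      { A          = A₂
      ; names      = names s
      ; ext        = ext s
      ; B          = B₁
      ; k<N        = k<N s
      ; names-mono = names-mono s
      ; ext-free   = ext-free s
      ; thick      = thick₂
      ; A-dense    = ≤-trans (A-dense s) (begin
          count (A s) * 4 ^ t * 4 ^ suc k         ≤⟨ *-monoˡ-≤ _ (*-monoˡ-≤ (4 ^ t) quarter) ⟩
          4 * count A₂ * 4 ^ t * 4 ^ suc k        ≡⟨ regroup 4 (count A₂) (4 ^ t) (4 ^ suc k) ⟩
          count A₂ * 4 ^ suc t * 4 ^ suc k        ∎)
      ; B-nonempty = λ i → n≢0⇒n>0 λ c≡0 → <⇒≱ (B-nonempty s i)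
                       (≤-trans (B₁-half i) (≤-reflexive (cong (2 *_) c≡0)))
      ; B-dense    = λ l → ≤-trans (B-dense s l) (begin
          count (B s (names s l)) * 2 ^ t         ≤⟨ *-monoˡ-≤ (2 ^ t) (B₁-half (names s l)) ⟩
          2 * count (B₁ (names s l)) * 2 ^ t      ≡⟨ regroup′ 2 (count (B₁ (names s l))) (2 ^ t) ⟩
          count (B₁ (names s l)) * 2 ^ suc t      ∎)
      ; status     = λ v → Status-mono shrink (status s v)
      } , λ ((a , a∈ , eq) , ys∈) → (a , A₂⊆ a a∈ , eq) , ys∈
    where
    open ≤-Reasoning
    shrink : ∀ {p} → Box A₂ (ext s) B₁ p → points s p
    shrink ((a , a∈ , eq) , ys∈) = (a , A₁⊆ a (A₂⊆ a a∈) , eq) , λ i → B₁⊆ i _ (ys∈ i)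
    regroup : ∀ c a u v → c * a * u * v ≡ a * (c * u) * v
    regroup = solve-∀
    regroup′ : ∀ c a u → c * a * u ≡ a * (c * u)
    regroup′ = solve-∀
    c : Fin (suc k) → ℕ
    c i = count (shadow A₁ i)
    shadows : 2 * D * sum c ≤ count A₁
    shadows = *-cancelˡ-≤ N (*-cancelˡ-≤ 2 (begin
      2 * (N * (2 * D * sum c))               ≡⟨ re₁ N D (sum c) ⟩
      4 * (N * D) * sum c                     ≡⟨ *-distribˡ-sum (4 * (N * D)) c ⟩
      sum (λ i → 4 * (N * D) * c i)           ≤⟨ sum-mono (λ i → ≤-trans (*-monoʳ-≤ (4 * (N * D))
                                                   (count-mono {A = shadow A₁ i} (shadow-mono A₁⊆ i))) (≤-trans (sat i) A₁-half)) ⟩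
      sum {suc k} (const (2 * count A₁))      ≡⟨ sum-const (suc k) _ ⟩
      suc k * (2 * count A₁)                  ≤⟨ *-monoˡ-≤ (2 * count A₁) (k<N s) ⟩
      N * (2 * count A₁)                      ≡⟨ re₂ N (count A₁) ⟩
      2 * (N * count A₁)                      ∎))
      where
      re₁ : ∀ N D s → 2 * (N * (2 * D * s)) ≡ 4 * (N * D) * s
      re₁ = solve-∀
      re₂ : ∀ N c → N * (2 * c) ≡ 2 * (N * c)
      re₂ = solve-∀
    half : count A₁ ≤ 2 * count A₂
    half = +-cancelʳ-≤ (count A₁) _ _ (begin
      count A₁ + count A₁                     ≡⟨ cong (_+_ (count A₁)) (+-identityʳ (count A₁)) ⟨
      2 * count A₁                            ≤⟨ *-monoʳ-≤ 2 (m+n≤o⇒m≤o (count A₁) Φ) ⟩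
      2 * (count A₂ + D * sum c)              ≡⟨ re (count A₂) D (sum c) ⟩
      2 * count A₂ + 2 * D * sum c            ≤⟨ +-monoʳ-≤ (2 * count A₂) shadows ⟩
      2 * count A₂ + count A₁                 ∎)
      where
      re : ∀ a D s → 2 * (a + D * s) ≡ 2 * a + 2 * D * s
      re = solve-∀
    quarter : count (A s) ≤ 4 * count A₂
    quarter = ≤-trans A₁-half (≤-trans (*-monoʳ-≤ 2 half) (≤-reflexive (sym (*-assoc 2 2 (count A₂)))))

  -- Linear forms in the variables have this shape, since each variable reads either the pointers or
  -- a single table. The part on `x` stays whole because `A` need not be a product.
  record Separable (g : Point → ℤ) : Set where
    field
      onA     : Vec (Fin m) N → ℤ
      onB     : Fin N → Vec (Fin N) m → ℤ
      separate : ∀ p → g p ≡ onA (proj₁ p) ℤ.+ ℤ∑.sum (λ i → onB i (proj₂ p i))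

  ∑-mono-≤ : ∀ {k} {f g : Fin k → ℤ} → (∀ i → f i ℤ.≤ g i) → ℤ∑.sum f ℤ.≤ ℤ∑.sum g
  ∑-mono-≤ {zero}  f≤g = ℤ.≤-refl
  ∑-mono-≤ {suc k} f≤g = ℤ.+-mono-≤ (f≤g zero) (∑-mono-≤ (f≤g ∘ suc))

  -- The medians of the parts add up to `total`. All upper halves together force `g` to be at least
  -- `total`, all lower halves at most `total`, and comparing `total` with `d` picks the useful
  -- choice.
  split : ∀ {t k} (s : State t k) → t + 2 ≤ N → ∀ {g} → Separable g → ∀ d →
    ∃[ l ] Σ[ s′ ∈ State (suc t) l ] s′ ⊑ s ×
      ((∀ {p} → points s′ p → d ℤ.≤ g p) ⊎ (∀ {p} → points s′ p → g p ℤ.< d))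
  split {t} {k} s₀ t+2≤N {g} sep d with l , s , sat , s⊑ ← saturate k s₀ t+2≤N = result
    where
    open Separable sep
    onA′ : Vec (Fin m) (suc l) → ℤ
    onA′ = onA ∘ ext s
    medA = median (A s) (A-nonempty s) onA′
    medB = λ i → median (B s i) (B-nonempty s i) (onB i)
    tA : ℤ
    tA = proj₁ medA
    tB : Fin N → ℤ
    tB i = proj₁ (medB i)
    total : ℤ
    total = tA ℤ.+ ℤ∑.sum tB
    upper = restrict s sat (atLeast (A s) onA′ tA) (λ a → ∧-elimˡ (A s a)) (proj₁ (proj₂ medA))
              (λ i → atLeast (B s i) (onB i) (tB i)) (λ i y → ∧-elimˡ (B s i y)) (λ i → proj₁ (proj₂ (medB i)))
    lower = restrict s sat (atMost (A s) onA′ tA) (λ a → ∧-elimˡ (A s a)) (proj₂ (proj₂ medA))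
              (λ i → atMost (B s i) (onB i) (tB i)) (λ i y → ∧-elimˡ (B s i y)) (λ i → proj₂ (proj₂ (medB i)))
    result : ∃[ l ] Σ[ s′ ∈ State (suc t) l ] s′ ⊑ s₀ ×
      ((∀ {p} → points s′ p → d ℤ.≤ g p) ⊎ (∀ {p} → points s′ p → g p ℤ.< d))
    result with d ℤ.≤? total
    ... | yes d≤ = l , proj₁ upper ,
      (λ p∈ → s⊑ (let (a , a∈ , eq) , ys∈ = proj₂ upper p∈ in
                  (a , ∧-elimˡ (A s a) a∈ , eq) , λ i → ∧-elimˡ (B s i _) (ys∈ i))) ,
      inj₁ λ {p} p∈ → ℤ.≤-trans d≤ (ℤ.≤-trans (above (proj₂ upper p∈)) (ℤ.≤-reflexive (sym (separate p))))
      where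
      above : ∀ {p} → Box (atLeast (A s) onA′ tA) (ext s) (λ i → atLeast (B s i) (onB i) (tB i)) p →
              total ℤ.≤ onA (proj₁ p) ℤ.+ ℤ∑.sum (λ i → onB i (proj₂ p i))
      above {_ , ys} ((a , a∈ , refl) , ys∈) = ℤ.+-mono-≤ (∧-elimʳ (A s a) (tA ℤ.≤? onA′ a) a∈)
        (∑-mono-≤ {f = tB} {g = λ i → onB i (ys i)}
          λ i → ∧-elimʳ (B s i (ys i)) (tB i ℤ.≤? onB i (ys i)) (ys∈ i))
    ... | no d≰ = l , proj₁ lower ,
      (λ p∈ → s⊑ (let (a , a∈ , eq) , ys∈ = proj₂ lower p∈ in
                  (a , ∧-elimˡ (A s a) a∈ , eq) , λ i → ∧-elimˡ (B s i _) (ys∈ i))) ,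
      inj₂ λ {p} p∈ → ℤ.≤-<-trans (ℤ.≤-reflexive (separate p)) (ℤ.≤-<-trans (below (proj₂ lower p∈)) (ℤ.≰⇒> d≰))
      where
      below : ∀ {p} → Box (atMost (A s) onA′ tA) (ext s) (λ i → atMost (B s i) (onB i) (tB i)) p →
              onA (proj₁ p) ℤ.+ ℤ∑.sum (λ i → onB i (proj₂ p i)) ℤ.≤ total
      below {_ , ys} ((a , a∈ , refl) , ys∈) = ℤ.+-mono-≤ (∧-elimʳ (A s a) (onA′ a ℤ.≤? tA) a∈)
        (∑-mono-≤ {f = λ i → onB i (ys i)} {g = tB}
          λ i → ∧-elimʳ (B s i (ys i)) (onB i (ys i) ℤ.≤? tB i) (ys∈ i))

-- Stabbing Planes trees and their points

toℚᵘ-fromℤ : ∀ z → toℚᵘ (fromℤ z) ≃ mkℚᵘ z 0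
toℚᵘ-fromℤ z = ℚ.toℚᵘ-fromℚᵘ (mkℚᵘ z 0)

fromℤ-injective : ∀ {a b} → fromℤ a ≡ fromℤ b → a ≡ b
fromℤ-injective {a} {b} eq with *≡* p ← ℚᵘ.≃-trans (ℚᵘ.≃-sym (toℚᵘ-fromℤ a))
                                          (ℚᵘ.≃-trans (ℚ.toℚᵘ-cong eq) (toℚᵘ-fromℤ b))
  = trans (sym (ℤ.*-identityʳ a)) (trans p (ℤ.*-identityʳ b))

fromℤ-+ : ∀ a b → fromℤ (a ℤ.+ b) ≡ fromℤ a ℚ.+ fromℤ b
fromℤ-+ a b = ℚ.toℚᵘ-injective (begin
  toℚᵘ (fromℤ (a ℤ.+ b))               ≈⟨ toℚᵘ-fromℤ (a ℤ.+ b) ⟩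
  mkℚᵘ (a ℤ.+ b) 0                     ≈⟨ *≡* (lemma a b) ⟩
  mkℚᵘ a 0 ℚᵘ.+ mkℚᵘ b 0               ≈⟨ ℚᵘ.+-cong (toℚᵘ-fromℤ a) (toℚᵘ-fromℤ b) ⟨
  toℚᵘ (fromℤ a) ℚᵘ.+ toℚᵘ (fromℤ b)   ≈⟨ ℚ.toℚᵘ-homo-+ (fromℤ a) (fromℤ b) ⟨
  toℚᵘ (fromℤ a ℚ.+ fromℤ b)           ∎)
  where
  open ℚᵘ.≃-Reasoning
  lemma : ∀ a b → (a ℤ.+ b) ℤ.* + 1 ≡ (a ℤ.* + 1 ℤ.+ b ℤ.* + 1) ℤ.* + 1
  lemma = ℤRing.solve-∀

fromℤ-* : ∀ a b → fromℤ (a ℤ.* b) ≡ fromℤ a ℚ.* fromℤ b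
fromℤ-* a b = ℚ.toℚᵘ-injective (begin
  toℚᵘ (fromℤ (a ℤ.* b))               ≈⟨ toℚᵘ-fromℤ (a ℤ.* b) ⟩
  mkℚᵘ a 0 ℚᵘ.* mkℚᵘ b 0               ≈⟨ ℚᵘ.*-cong (toℚᵘ-fromℤ a) (toℚᵘ-fromℤ b) ⟨
  toℚᵘ (fromℤ a) ℚᵘ.* toℚᵘ (fromℤ b)   ≈⟨ ℚ.toℚᵘ-homo-* (fromℤ a) (fromℤ b) ⟨
  toℚᵘ (fromℤ a ℚ.* fromℤ b)           ∎)
  where open ℚᵘ.≃-Reasoning

↧*≡↥ : ∀ w → fromℤ (↧ w) ℚ.* w ≡ fromℤ (↥ w)
↧*≡↥ w = ℚ.toℚᵘ-injective (begin
  toℚᵘ (fromℤ (↧ w) ℚ.* w)             ≈⟨ ℚ.toℚᵘ-homo-* (fromℤ (↧ w)) w ⟩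
  toℚᵘ (fromℤ (↧ w)) ℚᵘ.* toℚᵘ w       ≈⟨ ℚᵘ.*-congʳ {toℚᵘ w} (toℚᵘ-fromℤ (↧ w)) ⟩
  mkℚᵘ (↧ w) 0 ℚᵘ.* toℚᵘ w             ≈⟨ cross w ⟩
  mkℚᵘ (↥ w) 0                         ≈⟨ toℚᵘ-fromℤ (↥ w) ⟨
  toℚᵘ (fromℤ (↥ w))                   ∎)
  where
  open ℚᵘ.≃-Reasoning
  lemma : ∀ n d → d ℤ.* n ℤ.* + 1 ≡ n ℤ.* (+ 1 ℤ.* d)
  lemma = ℤRing.solve-∀
  cross : ∀ w → mkℚᵘ (↧ w) 0 ℚᵘ.* toℚᵘ w ≃ mkℚᵘ (↥ w) 0
  cross (mkℚ n d _) = *≡* (lemma n (+ suc d))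

-- Conic combinations with natural multipliers

module _ {X : Set} where

  combine : (X → ℤ) → ∀ {M} → Vec ℕ M → Vec X M → ℤ
  combine g []       []      = 0ℤ
  combine g (w ∷ ws) (e ∷ S) = + w ℤ.* g e ℤ.+ combine g ws S

  combine-cong : ∀ {g h : X → ℤ} → (∀ e → g e ≡ h e) → ∀ {M} (ws : Vec ℕ M) S →
                 combine g ws S ≡ combine h ws S
  combine-cong g≡h []       []      = refl
  combine-cong g≡h (w ∷ ws) (e ∷ S) = cong₂ (λ a b → + w ℤ.* a ℤ.+ b) (g≡h e) (combine-cong g≡h ws S)

  combine-+ : ∀ (g h : X → ℤ) {M} (ws : Vec ℕ M) S →
              combine (λ e → g e ℤ.+ h e) ws S ≡ combine g ws S ℤ.+ combine h ws S
  combine-+ g h []       []      = refl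
  combine-+ g h (w ∷ ws) (e ∷ S) = trans (cong (ℤ._+_ (+ w ℤ.* (g e ℤ.+ h e))) (combine-+ g h ws S))
                                         (regroup (+ w) (g e) (h e) _ _)
    where
    regroup : ∀ w a b x y → w ℤ.* (a ℤ.+ b) ℤ.+ (x ℤ.+ y) ≡ w ℤ.* a ℤ.+ x ℤ.+ (w ℤ.* b ℤ.+ y)
    regroup = ℤRing.solve-∀

  combine-* : ∀ (g : X → ℤ) c {M} (ws : Vec ℕ M) S → combine (λ e → g e ℤ.* c) ws S ≡ combine g ws S ℤ.* c
  combine-* g c []       []      = refl
  combine-* g c (w ∷ ws) (e ∷ S) = trans (cong (ℤ._+_ (+ w ℤ.* (g e ℤ.* c))) (combine-* g c ws S))
                                         (regroup (+ w) (g e) c _)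
    where
    regroup : ∀ w a c x → w ℤ.* (a ℤ.* c) ℤ.+ x ℤ.* c ≡ (w ℤ.* a ℤ.+ x) ℤ.* c
    regroup = ℤRing.solve-∀

  combine-0 : ∀ {M} (ws : Vec ℕ M) S → combine (const 0ℤ) ws S ≡ 0ℤ
  combine-0 []       []      = refl
  combine-0 (w ∷ ws) (e ∷ S) = cong₂ ℤ._+_ (ℤ.*-zeroʳ (+ w)) (combine-0 ws S)

  combine-sum : ∀ {v} (g : X → Fin v → ℤ) {M} (ws : Vec ℕ M) S →
                combine (λ e → ℤ∑.sum (g e)) ws S ≡ ℤ∑.sum (λ i → combine (λ e → g e i) ws S)
  combine-sum {zero}  g ws S = combine-0 ws S
  combine-sum {suc v} g ws S = trans (combine-+ (λ e → g e zero) _ ws S)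
                                     (cong (ℤ._+_ (combine (λ e → g e zero) ws S)) (combine-sum (λ e → g e ∘ suc) ws S))

  combine-≥0 : ∀ {g : X → ℤ} {M} (ws : Vec ℕ M) {S} → All (λ e → 0ℤ ℤ.≤ g e) S → 0ℤ ℤ.≤ combine g ws S
  combine-≥0 []       []       = ℤ.≤-refl
  combine-≥0 (w ∷ ws) (p ∷ ps) =
    ℤ.+-mono-≤ (ℤ.≤-trans (ℤ.≤-reflexive (sym (ℤ.*-zeroʳ (+ w)))) (ℤ.*-monoˡ-≤-nonNeg (+ w) p)) (combine-≥0 ws ps)

  fromℤ-combine : ∀ (g : X → ℤ) {M} (ws : Vec ℕ M) S →
    ∑ (zipWith (λ w e → w ℚ.* fromℤ (g e)) (Vec.map (fromℤ ∘ +_) ws) S) ≡ fromℤ (combine g ws S)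
  fromℤ-combine g []       []      = refl
  fromℤ-combine g (w ∷ ws) (e ∷ S) = trans (cong₂ ℚ._+_ (sym (fromℤ-* (+ w) (g e))) (fromℤ-combine g ws S))
                                           (sym (fromℤ-+ (+ w ℤ.* g e) _))

  -- Clears denominators. The multipliers and the common denominator do not depend on `g`, so they
  -- serve every coefficient and the bound at once.
  integral-multiple : ∀ {M} (ws : Vec ℚ M) → All NonNegative ws → ∃[ Δ ] Σ[ zs ∈ Vec ℕ M ]
    ∀ (g : X → ℤ) S → fromℤ (combine g zs S) ≡ fromℤ (+ suc Δ) ℚ.* ∑ (zipWith (λ w e → w ℚ.* fromℤ (g e)) ws S)
  integral-multiple [] [] = 0 , [] , λ { g [] → refl }
  integral-multiple (w@(mkℚ (+ a) d _) ∷ ws) (_ ∷ nn) with Δ , zs , eq ← integral-multiple ws nn =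
    -- The successor of this number is `suc d * suc Δ`, the new common denominator.
    Δ + d * suc Δ , a * suc Δ ∷ Vec.map (suc d *_) zs , λ { g (e ∷ S) → begin
      fromℤ (+ (a * suc Δ) ℤ.* g e ℤ.+ combine g (Vec.map (suc d *_) zs) S)
        ≡⟨ cong₂ (λ x y → fromℤ (x ℤ.* g e ℤ.+ y)) (ℤ.pos-* a (suc Δ)) (scale g (suc d) zs S) ⟩
      fromℤ (+ a ℤ.* + suc Δ ℤ.* g e ℤ.+ + suc d ℤ.* combine g zs S)
        ≡⟨ fromℤ-+ (+ a ℤ.* + suc Δ ℤ.* g e) _ ⟩
      fromℤ (+ a ℤ.* + suc Δ ℤ.* g e) ℚ.+ fromℤ (+ suc d ℤ.* combine g zs S)
        ≡⟨ cong₂ ℚ._+_ (head (g e)) (trans (fromℤ-* (+ suc d) (combine g zs S))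
             (trans (cong (ℚ._*_ (fromℤ (+ suc d))) (eq g S)) (sym (ℚ.*-assoc (fromℤ (+ suc d)) _ _)))) ⟩
      fromℤ (+ suc d) ℚ.* fromℤ (+ suc Δ) ℚ.* (w ℚ.* fromℤ (g e)) ℚ.+
      fromℤ (+ suc d) ℚ.* fromℤ (+ suc Δ) ℚ.* ∑ (zipWith (λ w e → w ℚ.* fromℤ (g e)) ws S)
        ≡⟨ ℚ.*-distribˡ-+ (fromℤ (+ suc d) ℚ.* fromℤ (+ suc Δ)) _ _ ⟨
      fromℤ (+ suc d) ℚ.* fromℤ (+ suc Δ) ℚ.* (w ℚ.* fromℤ (g e) ℚ.+ ∑ (zipWith (λ w e → w ℚ.* fromℤ (g e)) ws S))
        ≡⟨ cong (ℚ._* _) (trans (sym (fromℤ-* (+ suc d) (+ suc Δ))) (cong fromℤ (sym (ℤ.pos-* (suc d) (suc Δ))))) ⟩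
      fromℤ (+ (suc d * suc Δ)) ℚ.* (w ℚ.* fromℤ (g e) ℚ.+ ∑ (zipWith (λ w e → w ℚ.* fromℤ (g e)) ws S))
        ∎ }
    where
    open ≡-Reasoning
    scale : ∀ g c {M} (zs : Vec ℕ M) S → combine g (Vec.map (c *_) zs) S ≡ + c ℤ.* combine g zs S
    scale g c []       []      = sym (ℤ.*-zeroʳ (+ c))
    scale g c (z ∷ zs) (e ∷ S) = trans (cong₂ (λ x y → x ℤ.* g e ℤ.+ y) (ℤ.pos-* c z) (scale g c zs S))
                                       (regroup (+ c) (+ z) (g e) _)
      where
      regroup : ∀ c z x y → c ℤ.* z ℤ.* x ℤ.+ c ℤ.* y ≡ c ℤ.* (z ℤ.* x ℤ.+ y)
      regroup = ℤRing.solve-∀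
    head : ∀ x → fromℤ (+ a ℤ.* + suc Δ ℤ.* x) ≡ fromℤ (+ suc d) ℚ.* fromℤ (+ suc Δ) ℚ.* (w ℚ.* fromℤ x)
    head x = begin
      fromℤ (+ a ℤ.* + suc Δ ℤ.* x)              ≡⟨ trans (fromℤ-* (+ a ℤ.* + suc Δ) x) (cong (ℚ._* fromℤ x) (fromℤ-* (+ a) (+ suc Δ))) ⟩
      fromℤ (+ a) ℚ.* F ℚ.* fromℤ x              ≡⟨ cong (λ z → z ℚ.* F ℚ.* fromℤ x) (↧*≡↥ w) ⟨
      E ℚ.* w ℚ.* F ℚ.* fromℤ x                  ≡⟨ cong (ℚ._* fromℤ x) (trans (ℚ.*-assoc E w F) (cong (E ℚ.*_) (ℚ.*-comm w F))) ⟩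
      E ℚ.* (F ℚ.* w) ℚ.* fromℤ x                ≡⟨ cong (ℚ._* fromℤ x) (ℚ.*-assoc E F w) ⟨
      E ℚ.* F ℚ.* w ℚ.* fromℤ x                  ≡⟨ ℚ.*-assoc (E ℚ.* F) w (fromℤ x) ⟩
      E ℚ.* F ℚ.* (w ℚ.* fromℤ x)                ∎
      where
      E F : ℚ
      E = fromℤ (+ suc d)
      F = fromℤ (+ suc Δ)

module _ {v : ℕ} where

  dot : Vec ℤ v → (Fin v → ℤ) → ℤ
  dot c p = ℤ∑.sum λ i → lookup c i ℤ.* p i

  slack : (Fin v → ℤ) → Inequality v → ℤ
  slack p e = dot (coeffs e) p ℤ.- bound e

  dot-neg : ∀ (c : Vec ℤ v) p → dot (Vec.map ℤ.-_ c) p ≡ ℤ.- dot c p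
  dot-neg c p = go c p
    where
    go : ∀ {v} (c : Vec ℤ v) (p : Fin v → ℤ) → ℤ∑.sum (λ i → lookup (Vec.map ℤ.-_ c) i ℤ.* p i) ≡ ℤ.- ℤ∑.sum (λ i → lookup c i ℤ.* p i)
    go []      p = refl
    go (x ∷ c) p = trans (cong₂ ℤ._+_ (sym (ℤ.neg-distribˡ-* x (p zero))) (go c (p ∘ suc)))
                         (sym (ℤ.neg-distrib-+ (x ℤ.* p zero) _))

  slack-≥ : ∀ {p} c d → d ℤ.≤ dot c p → 0ℤ ℤ.≤ slack p (c ≥′ d)
  slack-≥ c d = ℤ.i≤j⇒0≤j-i

  slack-≤ : ∀ {p} c d → dot c p ℤ.< d → 0ℤ ℤ.≤ slack p (c ≤′ d ℤ.- 1ℤ)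
  slack-≤ {p} c d dot<d = ℤ.≤-trans (ℤ.i≤j⇒0≤j-i (ℤ.i<j⇒suc[i]≤j dot<d)) (ℤ.≤-reflexive
    (trans (regroup (dot c p) d) (cong (ℤ._- ℤ.- (d ℤ.- 1ℤ)) (sym (dot-neg c p)))))
    where
    regroup : ∀ x d → d ℤ.- (1ℤ ℤ.+ x) ≡ ℤ.- x ℤ.- (ℤ.- (d ℤ.- 1ℤ))
    regroup = ℤRing.solve-∀

  -- With all coefficients zero and bound `+ suc Δ`, the combined slack is the constant `-[1+ Δ ]`,
  -- whatever the point.
  leaf-slack : ∀ {M} {S : System v M} → ConicContradiction S →
               ∃[ zs ] ∀ p → combine (slack p) zs S ℤ.< 0ℤ
  leaf-slack {S = S} cc with Δ , zs , eq ← integral-multiple (ConicContradiction.ws cc) (ConicContradiction.nonNegative cc)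
    = zs , λ p → ℤ.≤-<-trans (ℤ.≤-reflexive (total p)) ℤ.-<+
    where
    open ConicContradiction cc
    coefficient : ∀ i → combine (λ e → lookup (coeffs e) i) zs S ≡ 0ℤ
    coefficient i = fromℤ-injective (trans (eq (λ e → lookup (coeffs e) i) S)
                      (trans (cong (fromℤ (+ suc Δ) ℚ.*_) (lhs≡0 i)) (ℚ.*-zeroʳ (fromℤ (+ suc Δ)))))
    constant : combine bound zs S ≡ + suc Δ
    constant = fromℤ-injective (trans (eq bound S)
                 (trans (cong (fromℤ (+ suc Δ) ℚ.*_) rhs≡1) (ℚ.*-identityʳ (fromℤ (+ suc Δ)))))
    total : ∀ p → combine (slack p) zs S ≡ -[1+ Δ ]
    total p = begin
      combine (slack p) zs S
        ≡⟨ combine-+ (λ e → dot (coeffs e) p) (λ e → ℤ.- bound e) zs S ⟩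
      combine (λ e → dot (coeffs e) p) zs S ℤ.+ combine (λ e → ℤ.- bound e) zs S
        ≡⟨ cong₂ ℤ._+_ lhs rhs ⟩
      -[1+ Δ ] ∎
      where
      open ≡-Reasoning
      lhs : combine (λ e → dot (coeffs e) p) zs S ≡ 0ℤ
      lhs = trans (combine-sum (λ e i → lookup (coeffs e) i ℤ.* p i) zs S)
           (trans (ℤ∑.sum-cong-≗ λ i → trans (combine-* (λ e → lookup (coeffs e) i) (p i) zs S)
                                             (cong (ℤ._* p i) (coefficient i)))
                  (ℤ∑.sum-replicate-zero v))
      rhs : combine (λ e → ℤ.- bound e) zs S ≡ -[1+ Δ ]
      rhs = trans (combine-cong (λ e → sym (trans (ℤ.*-comm (bound e) ℤ.-1ℤ) (ℤ.-1*i≡-i (bound e)))) zs S)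
           (trans (combine-* bound ℤ.-1ℤ zs S)
           (trans (cong (ℤ._* ℤ.-1ℤ) constant) (trans (ℤ.*-comm (+ suc Δ) ℤ.-1ℤ) (ℤ.-1*i≡-i (+ suc Δ)))))

  -- An integer point always satisfies one of the two edge labels, so it can be followed to a leaf.
  sound : ∀ {M} {S : System v M} → SP S → ∀ p → ¬ All (λ e → 0ℤ ℤ.≤ slack p e) S
  sound (leaf cc)      p ok = let zs , neg = leaf-slack cc in ℤ.<⇒≱ (neg p) (combine-≥0 zs ok)
  sound (node c d l r) p ok with d ℤ.≤? dot c p
  ... | yes d≤ = sound r p (slack-≥ c d d≤ ∷ ok)
  ... | no d≰  = sound l p (slack-≤ c d (ℤ.≰⇒> d≰) ∷ ok)

-- The adversary against a tree

module _ {n m D : ℕ} {{_ : NonZero m}} (parameters : Parameters n m D) where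

  open Adversary parameters

  Separable-+ : ∀ {f g} → Separable f → Separable g → Separable (λ p → f p ℤ.+ g p)
  Separable-+ F G = record
    { onA      = λ x → F.onA x ℤ.+ G.onA x
    ; onB      = λ i y → F.onB i y ℤ.+ G.onB i y
    ; separate = λ (x , ys) → trans (cong₂ ℤ._+_ (F.separate (x , ys)) (G.separate (x , ys)))
        (trans (regroup (F.onA x) _ (G.onA x) _)
               (cong (ℤ._+_ (F.onA x ℤ.+ G.onA x))
                 (sym (ℤ∑.∑-distrib-+ (λ i → F.onB i (ys i)) (λ i → G.onB i (ys i))))))
    }
    where
    module F = Separable F
    module G = Separable G
    regroup : ∀ a b c d → a ℤ.+ b ℤ.+ (c ℤ.+ d) ≡ a ℤ.+ c ℤ.+ (b ℤ.+ d)
    regroup = ℤRing.solve-∀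

  Separable-* : ∀ c {f} → Separable f → Separable (λ p → c ℤ.* f p)
  Separable-* c F = record
    { onA      = λ x → c ℤ.* F.onA x
    ; onB      = λ i y → c ℤ.* F.onB i y
    ; separate = λ (x , ys) → trans (cong (c ℤ.*_) (F.separate (x , ys)))
        (trans (ℤ.*-distribˡ-+ c (F.onA x) _)
               (cong (ℤ._+_ (c ℤ.* F.onA x)) (ℤ∑.*-distribˡ-sum c λ i → F.onB i (ys i))))
    }
    where module F = Separable F

  Separable-onA : ∀ (f : Vec (Fin m) N → ℤ) → Separable (f ∘ proj₁)
  Separable-onA f = record
    { onA      = f
    ; onB      = λ _ _ → 0ℤ
    ; separate = λ (x , _) → sym (trans (cong (ℤ._+_ (f x)) (ℤ∑.sum-replicate-zero N)) (ℤ.+-identityʳ (f x)))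
    }

  Separable-onB : ∀ i (f : Vec (Fin N) m → ℤ) → Separable (λ p → f (proj₂ p i))
  Separable-onB i f = record
    { onA      = const 0ℤ
    ; onB      = λ i′ y → if does (i′ Fin.≟ i) then f y else 0ℤ
    ; separate = λ (_ , ys) → sym (trans (ℤ.+-identityˡ _) (single (f ∘ ys) i))
    }
    where
    single : ∀ {k} (g : Fin k → ℤ) i → ℤ∑.sum (λ i′ → if does (i′ Fin.≟ i) then g i′ else 0ℤ) ≡ g i
    single {suc k} g zero    = trans (cong (ℤ._+_ (g zero)) (ℤ∑.sum-replicate-zero k)) (ℤ.+-identityʳ (g zero))
    single {suc k} g (suc i) = trans (ℤ.+-identityˡ _) (single (g ∘ suc) i)

  Separable-sum : ∀ {v} {f : Fin v → Point → ℤ} → (∀ i → Separable (f i)) → Separable (λ p → ℤ∑.sum (λ i → f i p))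
  Separable-sum {zero}  F = Separable-onA (const 0ℤ)
  Separable-sum {suc v} F = Separable-+ (F zero) (Separable-sum (F ∘ suc))

  total : List (Point → ℤ) → Point → ℤ
  total []       p = 0ℤ
  total (g ∷ gs) p = g p ℤ.+ total gs p

  total-++ : ∀ gs hs p → total (gs List.++ hs) p ≡ total gs p ℤ.+ total hs p
  total-++ []       hs p = sym (ℤ.+-identityˡ _)
  total-++ (g ∷ gs) hs p = trans (cong (ℤ._+_ (g p)) (total-++ gs hs p)) (sym (ℤ.+-assoc (g p) _ _))

  Separable-total : ∀ {gs} → ListAll.All Separable gs → Separable (total gs)
  Separable-total []       = Separable-onA (const 0ℤ)
  Separable-total (G ∷ Gs) = Separable-+ G (Separable-total Gs)

  NegativeOn : ∀ {t k} → State t k → (Point → ℤ) → Set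
  NegativeOn s g = ∀ {p} → State.points s p → g p ℤ.< 0ℤ

  -- Branch on the sign of the front half. If it is made nonnegative, the back half stays negative
  -- because the total is; either way half of the list remains.
  bisect : ∀ L gs → ListAll.All Separable gs → length gs ≤ 2 ^ L →
    ∀ {t k} (s : State t k) → t + L + 2 ≤ N → NegativeOn s (total gs) →
    ∃[ u ] ∃[ l ] Σ[ s′ ∈ State u l ] s′ ⊑ s × Any (NegativeOn s′) gs
  bisect zero [] _ _ s _ neg = let _ , p∈ = inhabited s in contradiction (neg p∈) (ℤ.<-irrefl refl)
  bisect zero (g ∷ []) _ _ s _ neg =
    _ , _ , s , id , here λ {p} p∈ → subst (ℤ._< 0ℤ) (ℤ.+-identityʳ (g p)) (neg p∈)
  bisect zero (_ ∷ _ ∷ _) _ (s≤s ()) _ _ _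
  bisect (suc L) gs Gs len {t} s room neg =
    go (split s (≤-trans (+-monoˡ-≤ 2 (m≤m+n t (suc L))) room)
              (Separable-total (ListAll.take⁺ (2 ^ L) Gs)) 0ℤ)
    where
    front back : List (Point → ℤ)
    front = take (2 ^ L) gs
    back  = drop (2 ^ L) gs
    room′ : suc t + L + 2 ≤ N
    room′ = subst (λ a → a + 2 ≤ N) (+-suc t L) room
    front-len : length front ≤ 2 ^ L
    front-len = ≤-trans (≤-reflexive (length-take (2 ^ L) gs)) (m⊓n≤m (2 ^ L) _)
    back-len : length back ≤ 2 ^ L
    back-len = ≤-trans (≤-reflexive (length-drop (2 ^ L) gs))
      (m≤n+o⇒m∸n≤o (length gs) (2 ^ L)
        (≤-trans len (≤-reflexive (cong (_+_ (2 ^ L)) (+-identityʳ (2 ^ L))))))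
    parts : ∀ p → total front p ℤ.+ total back p ≡ total gs p
    parts p = trans (sym (total-++ front back p)) (cong (λ hs → total hs p) (take++drop≡id (2 ^ L) gs))
    go : ∃[ l ] Σ[ s′ ∈ State (suc t) l ] s′ ⊑ s ×
           ((∀ {p} → State.points s′ p → 0ℤ ℤ.≤ total front p) ⊎ NegativeOn s′ (total front)) →
         ∃[ u ] ∃[ l ] Σ[ s′ ∈ State u l ] s′ ⊑ s × Any (NegativeOn s′) gs
    go (_ , s₁ , s₁⊑ , inj₂ neg₁)
      with u , l , s₂ , s₂⊑ , any ← bisect L front (ListAll.take⁺ (2 ^ L) Gs) front-len s₁ room′ neg₁
      = u , l , s₂ , (λ p∈ → s₁⊑ (s₂⊑ p∈)) ,
        subst (Any (NegativeOn s₂)) (take++drop≡id (2 ^ L) gs) (Any.++⁺ˡ any)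
    go (_ , s₁ , s₁⊑ , inj₁ pos₁)
      with u , l , s₂ , s₂⊑ , any ← bisect L back (ListAll.drop⁺ (2 ^ L) Gs) back-len s₁ room′
             (λ {p} p∈ → ℤ.≤-<-trans
               (ℤ.≤-trans (ℤ.≤-reflexive (sym (ℤ.+-identityˡ _))) (ℤ.+-monoˡ-≤ (total back p) (pos₁ p∈)))
               (subst (ℤ._< 0ℤ) (sym (parts p)) (neg (s₁⊑ p∈))))
      = u , l , s₂ , (λ p∈ → s₁⊑ (s₂⊑ p∈)) ,
        subst (Any (NegativeOn s₂)) (take++drop≡id (2 ^ L) gs) (Any.++⁺ʳ front any)

  module _ {v : ℕ} (val : Point → Fin v → ℤ) (val-separable : ∀ i → Separable (λ p → val p i)) where

    dot-separable : ∀ c → Separable (λ p → dot c (val p))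
    dot-separable c = Separable-sum λ i → Separable-* (lookup c i) (val-separable i)

    slack-separable : ∀ e → Separable (λ p → slack (val p) e)
    slack-separable e = Separable-+ (dot-separable (coeffs e)) (Separable-onA (const (ℤ.- bound e)))

    -- Weaker than holding on the box: no later box makes `e` fail at all of its points. This form
    -- passes to later boxes and is what a leaf contradicts.
    Unviolated : ∀ {t k} → State t k → Inequality v → Set
    Unviolated s e = ∀ {u l} (s′ : State u l) → s′ ⊑ s → ¬ NegativeOn s′ (λ p → slack (val p) e)

    holds⇒unviolated : ∀ {t k} (s : State t k) e → (∀ {p} → State.points s p → 0ℤ ℤ.≤ slack (val p) e) →
                       Unviolated s e
    holds⇒unviolated s e holds s′ s′⊑ neg = let _ , p∈ = inhabited s′ in ℤ.<⇒≱ (neg p∈) (holds (s′⊑ p∈))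

    unviolated-⊑ : ∀ {t k u l} (s : State t k) (s′ : State u l) e → s′ ⊑ s → Unviolated s e → Unviolated s′ e
    unviolated-⊑ s s′ e s′⊑ ok s″ s″⊑ = ok s″ λ p∈ → s′⊑ (s″⊑ p∈)

    weighted : ∀ {M} → Vec ℕ M → System v M → List (Point → ℤ)
    weighted []       []      = []
    weighted (w ∷ ws) (e ∷ S) = (λ p → + w ℤ.* slack (val p) e) ∷ weighted ws S

    weighted-separable : ∀ {M} (ws : Vec ℕ M) S → ListAll.All Separable (weighted ws S)
    weighted-separable []       []      = []
    weighted-separable (w ∷ ws) (e ∷ S) = Separable-* (+ w) (slack-separable e) ∷ weighted-separable ws S

    length-weighted : ∀ {M} (ws : Vec ℕ M) S → length (weighted ws S) ≡ M
    length-weighted []       []      = refl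
    length-weighted (w ∷ ws) (e ∷ S) = cong suc (length-weighted ws S)

    total-weighted : ∀ {M} (ws : Vec ℕ M) S p → total (weighted ws S) p ≡ combine (slack (val p)) ws S
    total-weighted []       []      p = refl
    total-weighted (w ∷ ws) (e ∷ S) p = cong (ℤ._+_ (+ w ℤ.* slack (val p) e)) (total-weighted ws S p)

    violated⇒⊥ : ∀ {M} (ws : Vec ℕ M) (S : System v M) {t k u l} (s : State t k) (s′ : State u l) → s′ ⊑ s →
                 All (Unviolated s) S → ¬ Any (NegativeOn s′) (weighted ws S)
    violated⇒⊥ []       []      s s′ s′⊑ []         ()
    violated⇒⊥ (w ∷ ws) (e ∷ S) s s′ s′⊑ (ok ∷ oks) (there any) = violated⇒⊥ ws S s s′ s′⊑ oks any
    violated⇒⊥ (w ∷ ws) (e ∷ S) s s′ s′⊑ (ok ∷ oks) (here neg)  = ok s′ s′⊑ λ p∈ →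
      ℤ.≰⇒> λ 0≤ → ℤ.<⇒≱ (neg p∈)
        (ℤ.≤-trans (ℤ.≤-reflexive (sym (ℤ.*-zeroʳ (+ w)))) (ℤ.*-monoˡ-≤-nonNeg (+ w) 0≤))

    -- Each level of the tree moves one unit from `depth π` to `t`, and one to the number of
    -- inequalities `M`, so both hypotheses are preserved. At the leaf they leave `L` branchings for
    -- bisection and the 2 that `saturate` requires.
    resist : ∀ {M} {S : System v M} L (π : SP S) {t k} (s : State t k) → All (Unviolated s) S →
             t + depth π + L + 2 ≤ N → M + depth π ≤ 2 ^ L → ⊥
    resist {M} {S} L (leaf cc) {t} s ok room size =
      let zs , neg = leaf-slack cc
          _ , _ , s′ , s′⊑ , any = bisect L (weighted zs S) (weighted-separable zs S)
            (≤-trans (≤-reflexive (length-weighted zs S)) (m+n≤o⇒m≤o M size)) s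
            (subst (λ a → a + L + 2 ≤ N) (+-identityʳ t) room)
            (λ {p} _ → subst (ℤ._< 0ℤ) (sym (total-weighted zs S p)) (neg (val p)))
      in violated⇒⊥ zs S s s′ s′⊑ ok any
    resist {M} {S} L (node c d l r) {t} s ok room size =
      go (split s (≤-trans (+-monoˡ-≤ 2 (≤-trans (m≤m+n t _) (m≤m+n _ L))) room) (dot-separable c) d)
      where
      deeper : ∀ {δ} → δ ≤ depth l ⊔ depth r → suc t + δ + L + 2 ≤ N
      deeper {δ} δ≤ = ≤-trans (+-monoˡ-≤ 2 (+-monoˡ-≤ L (≤-trans (≤-reflexive (sym (+-suc t δ)))
                               (+-monoʳ-≤ t (s≤s δ≤))))) room
      wider : ∀ {δ} → δ ≤ depth l ⊔ depth r → suc M + δ ≤ 2 ^ L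
      wider {δ} δ≤ = ≤-trans (≤-trans (≤-reflexive (sym (+-suc M δ))) (+-monoʳ-≤ M (s≤s δ≤))) size
      go : ∃[ k ] Σ[ s′ ∈ State (suc t) k ] s′ ⊑ s ×
             ((∀ {p} → State.points s′ p → d ℤ.≤ dot c (val p)) ⊎ (∀ {p} → State.points s′ p → dot c (val p) ℤ.< d)) → ⊥
      go (_ , s′ , s′⊑ , inj₁ ge) = resist L r s′
        (holds⇒unviolated s′ (c ≥′ d) (λ p∈ → slack-≥ c d (ge p∈)) ∷
         VecAll.map (λ {e} → unviolated-⊑ s s′ e s′⊑) ok)
        (deeper (m≤n⊔m _ _)) (wider (m≤n⊔m _ _))
      go (_ , s′ , s′⊑ , inj₂ lt) = resist L l s′
        (holds⇒unviolated s′ (c ≤′ d ℤ.- 1ℤ) (λ p∈ → slack-≤ c d (lt p∈)) ∷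
         VecAll.map (λ {e} → unviolated-⊑ s s′ e s′⊑) ok)
        (deeper (m≤m⊔n _ _)) (wider (m≤m⊔n _ _))

-- The formula

δ : ∀ {v} → Fin v → Fin v → ℕ
δ i u = ⟦ does (u Fin.≟ i) ⟧

sum-δ : ∀ {v} (i : Fin v) → sum (δ i) ≡ 1
sum-δ {suc v} zero    = cong suc (sum-replicate-zero v)
sum-δ {suc v} (suc i) = sum-δ i

pos-sum : ∀ {v} (f : Fin v → ℕ) → + sum f ≡ ℤ∑.sum (λ i → + f i)
pos-sum {zero}  f = refl
pos-sum {suc v} f = trans (ℤ.pos-+ (f zero) _) (cong (ℤ._+_ (+ f zero)) (pos-sum (f ∘ suc)))

module _ {v : ℕ} where

  open ListMembership (Fin._≟_ {v}) using (_∈?_)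

  members : List (Fin v) → Subset v
  members vs = Vec.tabulate λ u → does (u ∈? vs)

  disjunction : List (Fin v) → List (Fin v) → Clause v
  disjunction ps qs = clause (members ps) (members qs)

  ∈-members : ∀ {u vs} → u ∈ vs → u Subset.∈ members vs
  ∈-members {u} {vs} u∈vs =
    lookup⇒[]= u (members vs) (trans (lookup∘tabulate _ u) (dec-true (u ∈? vs) u∈vs))

  ⊨-pos : ∀ (α : Assignment v) ps qs {u} → u ∈ ps → α u ≡ true → α ⊨ disjunction ps qs
  ⊨-pos α ps qs u∈ αu = inj₁ (_ , ∈-members u∈ , αu)

  ⊨-neg : ∀ (α : Assignment v) ps qs {u} → u ∈ qs → α u ≡ false → α ⊨ disjunction ps qs
  ⊨-neg α ps qs u∈ αu = inj₂ (_ , ∈-members u∈ , αu)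

  multiplicity : List (Fin v) → Fin v → ℕ
  multiplicity []       u = 0
  multiplicity (i ∷ vs) u = δ i u + multiplicity vs u

  -- A repeated variable would count twice on the left and once on the right, hence `Unique`.
  multiplicity-unique : ∀ {vs} → Unique vs → ∀ u → multiplicity vs u ≡ ⟦ lookup (members vs) u ⟧
  multiplicity-unique {vs} uniq u = trans (go uniq) (cong ⟦_⟧ (sym (lookup∘tabulate _ u)))
    where
    go : ∀ {vs} → Unique vs → multiplicity vs u ≡ ⟦ does (u ∈? vs) ⟧
    absent : ∀ {vs} → ListAll.All (u ≢_) vs → multiplicity vs u ≡ 0
    absent []           = refl
    absent (u≢ ∷ rest) rewrite dec-false (u Fin.≟ _) u≢ = absent rest
    go [] = refl
    go {i ∷ vs} (i∉ ∷ uniq) with u Fin.≟ i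
    ... | yes refl = cong suc (absent i∉)
    ... | no  u≢i  = trans (go uniq) (cong ⟦_⟧ (refl {x = does (u ∈? vs)}))

  sum-multiplicity : ∀ vs → sum (multiplicity vs) ≡ length vs
  sum-multiplicity []       = sum-replicate-zero v
  sum-multiplicity (i ∷ vs) = trans (∑-distrib-+ (δ i) (multiplicity vs))
                                    (cong₂ _+_ (sum-δ i) (sum-multiplicity vs))

  ∣∣-sum : ∀ {v} (p : Subset v) → ∣ p ∣ ≡ sum (λ u → ⟦ lookup p u ⟧)
  ∣∣-sum []          = refl
  ∣∣-sum (true ∷ p)  = cong suc (∣∣-sum p)
  ∣∣-sum (false ∷ p) = ∣∣-sum p

  clause-coefficient : ∀ (pos neg : Subset v) u →
    lookup (coeffs (clauseInequality (clause pos neg))) u ≡ + ⟦ lookup pos u ⟧ ℤ.- + ⟦ lookup neg u ⟧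
  clause-coefficient pos neg u rewrite lookup-zipWith
    (λ p q → (if p then 1ℤ else 0ℤ) ℤ.- (if q then 1ℤ else 0ℤ)) u pos neg with lookup pos u | lookup neg u
  ... | true  | true  = refl
  ... | true  | false = refl
  ... | false | true  = refl
  ... | false | false = refl

  disjunction-coefficient : ∀ {ps qs} → Unique ps → Unique qs → ∀ u →
    lookup (coeffs (clauseInequality (disjunction ps qs))) u ≡ + multiplicity ps u ℤ.- + multiplicity qs u
  disjunction-coefficient {ps} {qs} P Q u = trans (clause-coefficient (members ps) (members qs) u)
    (sym (cong₂ (λ a b → + a ℤ.- + b) (multiplicity-unique P u) (multiplicity-unique Q u)))

  disjunction-bound : ∀ {ps qs} → Unique qs →
    bound (clauseInequality (disjunction ps qs)) ≡ 1ℤ ℤ.- + length qs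
  disjunction-bound {ps} {qs} Q = cong (λ k → 1ℤ ℤ.- + k)
    (trans (∣∣-sum (members qs)) (trans (sum-cong-≗ λ u → sym (multiplicity-unique Q u)) (sum-multiplicity qs)))

  toℤ : Assignment v → Fin v → ℤ
  toℤ α u = + ⟦ α u ⟧

  -- At a Boolean point the slack is the number of true literals minus one.
  satisfied⇒slack : ∀ (α : Assignment v) C → α ⊨ C → 0ℤ ℤ.≤ slack (toℤ α) (clauseInequality C)
  satisfied⇒slack α (clause pos neg) sat = ℤ.≤-trans (ℤ.i≤j⇒0≤j-i (ℤ.+≤+ {1} (some sat))) (ℤ.≤-reflexive
    (trans (cong (ℤ._- 1ℤ) count-true) (regroup (dot (coeffs (clauseInequality (clause pos neg))) (toℤ α)) (+ ∣ neg ∣))))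
    where
    P Q : Fin v → Bool
    P = lookup pos
    Q = lookup neg
    true-literals : Fin v → ℕ
    true-literals u = ⟦ P u ∧ α u ⟧ + ⟦ Q u ∧ not (α u) ⟧
    regroup : ∀ d k → d ℤ.+ k ℤ.- 1ℤ ≡ d ℤ.- (1ℤ ℤ.- k)
    regroup = ℤRing.solve-∀
    some : α ⊨ clause pos neg → 1 ≤ sum true-literals
    some (inj₁ (i , i∈ , αi)) = ≤-trans (subst (1 ≤_) (cong₂ (λ p a → ⟦ p ∧ a ⟧ + ⟦ Q i ∧ not a ⟧) (sym ([]=⇒lookup i∈)) (sym αi)) (s≤s z≤n)) (term≤sum true-literals i)
    some (inj₂ (j , j∈ , αj)) = ≤-trans (subst (1 ≤_) (cong₂ (λ q a → ⟦ P j ∧ a ⟧ + ⟦ q ∧ not a ⟧) (sym ([]=⇒lookup j∈)) (sym αj)) (m≤n+m 1 ⟦ P j ∧ false ⟧)) (term≤sum true-literals j)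
    literal : ∀ p q a → + (⟦ p ∧ a ⟧ + ⟦ q ∧ not a ⟧) ≡ (+ ⟦ p ⟧ ℤ.- + ⟦ q ⟧) ℤ.* + ⟦ a ⟧ ℤ.+ + ⟦ q ⟧
    literal true  true  true  = refl
    literal true  true  false = refl
    literal true  false true  = refl
    literal true  false false = refl
    literal false true  true  = refl
    literal false true  false = refl
    literal false false true  = refl
    literal false false false = refl
    count-true : + sum true-literals ≡ dot (coeffs (clauseInequality (clause pos neg))) (toℤ α) ℤ.+ + ∣ neg ∣
    count-true = begin
      + sum true-literals
        ≡⟨ pos-sum true-literals ⟩
      ℤ∑.sum (λ u → + true-literals u)
        ≡⟨ ℤ∑.sum-cong-≗ (λ u → trans (literal (P u) (Q u) (α u))
             (cong (λ c → c ℤ.* toℤ α u ℤ.+ + ⟦ Q u ⟧) (sym (clause-coefficient pos neg u)))) ⟩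
      ℤ∑.sum (λ u → lookup c u ℤ.* toℤ α u ℤ.+ + ⟦ Q u ⟧)
        ≡⟨ ℤ∑.∑-distrib-+ (λ u → lookup c u ℤ.* toℤ α u) (λ u → + ⟦ Q u ⟧) ⟩
      dot c (toℤ α) ℤ.+ ℤ∑.sum (λ u → + ⟦ Q u ⟧)
        ≡⟨ cong (ℤ._+_ (dot c (toℤ α))) (trans (sym (pos-sum (λ u → ⟦ Q u ⟧))) (cong +_ (sym (∣∣-sum neg)))) ⟩
      dot c (toℤ α) ℤ.+ + ∣ neg ∣
        ∎
      where
      open ≡-Reasoning
      c : Vec ℤ v
      c = coeffs (clauseInequality (clause pos neg))

  unit-coefficient : ∀ (i u : Fin v) → lookup (unit i) u ≡ + δ i u
  unit-coefficient i u with u Fin.≟ i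
  ... | yes refl = lookup∘update i (Vec.replicate v 0ℤ) 1ℤ
  ... | no u≢i   = trans (lookup∘update′ u≢i (Vec.replicate v 0ℤ) 1ℤ) (lookup-replicate u 0ℤ)

  dot-unit : ∀ i (p : Fin v → ℤ) → dot (unit i) p ≡ p i
  dot-unit i p = trans (ℤ∑.sum-cong-≗ λ u → cong (ℤ._* p u) (unit-coefficient i u)) (single i p)
    where
    single : ∀ {v} (i : Fin v) (p : Fin v → ℤ) → ℤ∑.sum (λ u → + δ i u ℤ.* p u) ≡ p i
    single {suc v} zero    p = trans (cong₂ ℤ._+_ (ℤ.*-identityˡ (p zero)) (ℤ∑.sum-replicate-zero v)) (ℤ.+-identityʳ (p zero))
    single {suc v} (suc i) p = trans (ℤ.+-identityˡ _) (single i (p ∘ suc))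

  All-encode : ∀ {p} {P : Inequality v → Set p} (F : CNF v) →
    (∀ i → P (unit i ≥′ 0ℤ)) → (∀ i → P (unit i ≤′ 1ℤ)) →
    ListAll.All (P ∘ clauseInequality) F → All P (encode F)
  All-encode F lower upper clauses =
    VecAll.++⁺ (VecAll.tabulate⁺ lower) (VecAll.++⁺ (VecAll.tabulate⁺ upper) (VecAll.map⁺ (VecAll.fromList⁺ clauses)))

  assignment-lower : ∀ (α : Assignment v) i → 0ℤ ℤ.≤ slack (toℤ α) (unit i ≥′ 0ℤ)
  assignment-lower α i = slack-≥ (unit i) 0ℤ (subst (0ℤ ℤ.≤_) (sym (dot-unit i (toℤ α))) (ℤ.+≤+ z≤n))

  assignment-upper : ∀ (α : Assignment v) i → 0ℤ ℤ.≤ slack (toℤ α) (unit i ≤′ 1ℤ)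
  assignment-upper α i = slack-≤ (unit i) (+ 2) (subst (ℤ._< + 2) (sym (dot-unit i (toℤ α))) (ℤ.+<+ (s≤s (⟦⟧≤1 (α i)))))

  refutation⇒unsatisfiable : ∀ {F : CNF v} → SPRefutation F → Unsatisfiable F
  refutation⇒unsatisfiable {F} π (α , sat) = sound π (toℤ α)
    (All-encode F (assignment-lower α) (assignment-upper α) (ListAll.map (λ {C} → satisfied⇒slack α C) sat))

module Formula (n m : ℕ) where

  N : ℕ
  N = suc n

  variables : ℕ
  variables = N * m + N * (m * N)

  pointer : Fin N → Fin m → Fin variables
  pointer i j = Fin.join (N * m) (N * (m * N)) (inj₁ (Fin.combine i j))

  target : Fin N → Fin m → Fin N → Fin variables
  target i j k = Fin.join (N * m) (N * (m * N)) (inj₂ (Fin.combine i (Fin.combine j k)))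

  decode : Fin variables → (Fin N × Fin m) ⊎ (Fin N × Fin m × Fin N)
  decode u = Sum.map (Fin.remQuot m) (map₂ (Fin.remQuot N) ∘ Fin.remQuot (m * N)) (Fin.splitAt (N * m) u)

  decode-pointer : ∀ i j → decode (pointer i j) ≡ inj₁ (i , j)
  decode-pointer i j = trans (cong (Sum.map _ _) (Fin.splitAt-join (N * m) (N * (m * N)) (inj₁ (Fin.combine i j))))
                             (cong inj₁ (Fin.remQuot-combine i j))

  decode-target : ∀ i j k → decode (target i j k) ≡ inj₂ (i , j , k)
  decode-target i j k = trans (cong (Sum.map _ _) (Fin.splitAt-join (N * m) (N * (m * N)) (inj₂ (Fin.combine i (Fin.combine j k)))))
    (cong inj₂ (trans (cong (map₂ (Fin.remQuot N)) (Fin.remQuot-combine i (Fin.combine j k)))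
                      (cong (i ,_) (Fin.remQuot-combine j k))))

  Step : Set
  Step = (Fin N × Fin N × Fin N) × Fin m × Fin m

  blocked? : (s : Step) → Dec (let (i , k , l) , _ = s in i Fin.< k × l Fin.≤ k)
  blocked? ((i , k , l) , _) = (i Fin.<? k) ×-dec (l Fin.≤? k)

  somePointer : Fin N → Clause variables
  somePointer i = disjunction (List.tabulate (pointer i)) []

  someTarget : Fin N × Fin m → Clause variables
  someTarget (i , j) = disjunction (List.tabulate (target i j)) []

  startMoves : Fin m → Clause variables
  startMoves j = disjunction [] (pointer zero j ∷ target zero j zero ∷ [])

  stepMoves : Step → Clause variables
  stepMoves ((i , k , l) , j , j′) =
    disjunction [] (pointer i j ∷ target i j k ∷ pointer k j′ ∷ target k j′ l ∷ [])

  steps : List Step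
  steps = List.cartesianProduct
    (List.cartesianProduct (List.allFin N) (List.cartesianProduct (List.allFin N) (List.allFin N)))
    (List.cartesianProduct (List.allFin m) (List.allFin m))

  pointerClauses targetClauses startClauses stepClauses : CNF variables
  pointerClauses = List.map somePointer (List.allFin N)
  targetClauses  = List.map someTarget (List.cartesianProduct (List.allFin N) (List.allFin m))
  startClauses   = List.map startMoves (List.allFin m)
  stepClauses    = List.map stepMoves (List.filter blocked? steps)

  -- With f(i) = y_i[x_i], where pointer i j means x_i = j and target i j k means y_i[j] = k:
  -- f is total, f(0) > 0, and f(i) > i implies f(f(i)) > f(i).
  formula : CNF variables
  formula = pointerClauses ++ targetClauses ++ startClauses ++ stepClauses

-- The adversary against the formula

module _ {n m D : ℕ} {{_ : NonZero m}} (parameters : Parameters n m D) where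

  open Adversary parameters
  open Parameters parameters
  open Formula n m hiding (N)

  decoded : Point → (Fin N × Fin m) ⊎ (Fin N × Fin m × Fin N) → Bool
  decoded (x , ys) (inj₁ (i , j))     = does (lookup x i Fin.≟ j)
  decoded (x , ys) (inj₂ (i , j , k)) = does (lookup (ys i) j Fin.≟ k)

  assignment : Point → Assignment variables
  assignment p = decoded p ∘ decode

  val : Point → Fin variables → ℤ
  val p = toℤ (assignment p)

  val-separable : ∀ u → Separable (λ p → val p u)
  val-separable u with decode u
  ... | inj₁ (i , j)     = Separable-onA parameters λ x → + ⟦ does (lookup x i Fin.≟ j) ⟧
  ... | inj₂ (i , j , k) = Separable-onB parameters i λ y → + ⟦ does (lookup y j Fin.≟ k) ⟧

  assignment-pointer : ∀ p i j → assignment p (pointer i j) ≡ does (lookup (proj₁ p) i Fin.≟ j)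
  assignment-pointer p i j = cong (decoded p) (decode-pointer i j)

  assignment-target : ∀ p i j k → assignment p (target i j k) ≡ does (lookup (proj₂ p i) j Fin.≟ k)
  assignment-target p i j k = cong (decoded p) (decode-target i j k)

  does⇒ : ∀ {k} {a b : Fin k} → does (a Fin.≟ b) ≡ true → a ≡ b
  does⇒ {a = a} {b} eq with yes a≡b ← a Fin.≟ b = a≡b

  module _ {t k} (s : State t k) where
    open State s

    -- A constant pointer would leave a single point in each fibre of `A` in direction `l`, against
    -- thickness.
    free-varies : ∀ l j → ¬ (∀ {p} → points p → lookup (proj₁ p) (names l) ≡ j)
    free-varies l j constant = contradiction 2≤D (<⇒≱ (s≤s D≤1))
      where
      ys : ∀ i → ∃ (_∈ˢ B i)
      ys i = count>0⇒∈ (B i) (B-nonempty i)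
      pointing : ∀ a → a ∈ˢ A → lookup a l ≡ j
      pointing a a∈ = trans (sym (ext-free a l)) (constant ((a , a∈ , refl) , proj₂ ∘ ys))
      D≤1 : D ≤ 1
      D≤1 = let a , a∈ = count>0⇒∈ A (A-nonempty s) in ≤-trans
        (thick l (removeAt a l) (lookup a l) (subst (_∈ˢ A) (sym (insertAt-removeAt a l)) a∈))
        (≤-trans (sum-mono λ j′ → ⟦⟧-mono λ p → dec-true (j′ Fin.≟ j)
                    (trans (sym (insertAt-lookup (removeAt a l) l j′)) (pointing _ p)))
                 (≤-reflexive (sum-δ j)))

  module _ {t k} (s : State t k) where
    open State s

    True : Fin variables → Set
    True u = ∀ {p} → points p → assignment p u ≡ true

    -- What a move clause falsified throughout the box yields: both literals true at every point. It
    -- is stronger than `Fixed`, where the slot may vary, and impossible for free nodes.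
    Steady : Fin N → Fin N → Set
    Steady i b = (∃[ j ] True (pointer i j) × True (target i j b))

    steady⇒fixed : ∀ {i b} → Steady i b → Fixed points i b
    steady⇒fixed {i} {b} (j , X , Y) {p} p∈ = trans
      (cong (lookup (proj₂ p i)) (does⇒ (trans (sym (assignment-pointer p i j)) (X p∈))))
      (does⇒ (trans (sym (assignment-target p i j b)) (Y p∈)))

    steady-free : ∀ {b} l → ¬ Steady (names l) b
    steady-free l (j , X , _) = free-varies s l j λ {p} p∈ →
      does⇒ (trans (sym (assignment-pointer p (names l) j)) (X p∈))

    fixed-unique : ∀ {i b c} → Fixed points i b → Fixed points i c → b ≡ c
    fixed-unique f g = let _ , p∈ = inhabited s in trans (sym (f p∈)) (g p∈)

    startMoves-safe : ∀ {b} → Steady zero b → zero {n} Fin.< b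
    startMoves-safe {b} st with status zero
    ... | free l eq      = contradiction (subst (λ i → Steady i b) (sym eq) st) (steady-free l)
    ... | stopped _ _ ()
    ... | moved f 0<b _  = subst (zero {n} Fin.<_) (fixed-unique f (steady⇒fixed st)) 0<b

    -- A free `i` is not steady and a stopped one does not go up. If `i` moved to `k`, then either
    -- `k` is free, hence not steady, or its fixed value lies above it.
    stepMoves-safe : ∀ {i k l} → Steady i k → i Fin.< k → Steady k l → k Fin.< l
    stepMoves-safe {i} {k} st i<k st′ with status i
    ... | free l eq       = contradiction (subst (λ i → Steady i k) (sym eq) st) (steady-free l)
    ... | stopped f b≤i _ = contradiction (subst (Fin._≤ i) (fixed-unique f (steady⇒fixed st)) b≤i) (<⇒≱ i<k)
    ... | moved f _ tgt with fixed-unique f (steady⇒fixed st)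
    ...   | refl with tgt
    ...     | inj₁ refl          = contradiction st′ (steady-free zero)
    ...     | inj₂ (c , g , b<c) = subst (k Fin.<_) (fixed-unique g (steady⇒fixed st′)) b<c

  not-false⇒true : ∀ {b} → ¬ b ≡ false → b ≡ true
  not-false⇒true {true}  _ = refl
  not-false⇒true {false} p = contradiction refl p

  clause-unviolated : ∀ {t k} (s : State t k) C →
    (∀ {u l} (s′ : State u l) → ¬ (∀ {p} → State.points s′ p → ¬ assignment p ⊨ C)) →
    Unviolated parameters val val-separable s (clauseInequality C)
  clause-unviolated s C ok s′ _ neg =
    ok s′ λ {p} p∈ sat → ℤ.<⇒≱ (neg p∈) (satisfied⇒slack (assignment p) C sat)

  formula-unviolated : ∀ {t k} (s : State t k) →
    All (Unviolated parameters val val-separable s) (encode formula)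
  formula-unviolated s = All-encode formula
    (λ i → holds⇒unviolated parameters val val-separable s (unit i ≥′ 0ℤ) λ {p} _ → assignment-lower (assignment p) i)
    (λ i → holds⇒unviolated parameters val val-separable s (unit i ≤′ 1ℤ) λ {p} _ → assignment-upper (assignment p) i)
    (ListAll.++⁺ (ListAll.map⁺ {f = somePointer} (ListAll.universal pointers (List.allFin N)))
    (ListAll.++⁺ (ListAll.map⁺ {f = someTarget} (ListAll.universal targets (List.cartesianProduct (List.allFin N) (List.allFin m))))
    (ListAll.++⁺ (ListAll.map⁺ {f = startMoves} (ListAll.universal starts (List.allFin m)))
                 (ListAll.map⁺ {f = stepMoves} (ListAll.map (λ {q} → moves q) (ListAll.all-filter blocked? steps))))))
    where
    Falsified : ∀ {u l} → State u l → Clause variables → Set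
    Falsified s′ C = ∀ {p} → State.points s′ p → ¬ assignment p ⊨ C
    somePointer-ok : ∀ i {u l} (s′ : State u l) → ¬ Falsified s′ (somePointer i)
    somePointer-ok i s′ falsified = let p , p∈ = inhabited s′ in falsified p∈
      (⊨-pos (assignment p) (List.tabulate (pointer i)) [] (∈-tabulate⁺ {f = pointer i} (lookup (proj₁ p) i))
        (trans (assignment-pointer p i _) (dec-true (_ Fin.≟ lookup (proj₁ p) i) refl)))
    someTarget-ok : ∀ q {u l} (s′ : State u l) → ¬ Falsified s′ (someTarget q)
    someTarget-ok (i , j) s′ falsified = let p , p∈ = inhabited s′ in falsified p∈
      (⊨-pos (assignment p) (List.tabulate (target i j)) [] (∈-tabulate⁺ {f = target i j} (lookup (proj₂ p i) j))
        (trans (assignment-target p i j _) (dec-true (_ Fin.≟ lookup (proj₂ p i) j) refl)))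
    all-true : ∀ {u l} (s′ : State u l) qs → Falsified s′ (disjunction [] qs) → ∀ {w} → w ∈ qs → True s′ w
    all-true s′ qs falsified w∈ {p} p∈ = not-false⇒true λ w≡false →
      falsified p∈ (⊨-neg (assignment p) [] qs w∈ w≡false)
    startMoves-ok : ∀ j {u l} (s′ : State u l) → ¬ Falsified s′ (startMoves j)
    startMoves-ok j s′ falsified = contradiction
      (startMoves-safe s′ (j , all-true s′ (pointer zero j ∷ target zero j zero ∷ []) falsified (here refl) , all-true s′ (pointer zero j ∷ target zero j zero ∷ []) falsified (there (here refl))))
      λ ()
    stepMoves-ok : ∀ q → (let (i , k , l) , _ = q in i Fin.< k × l Fin.≤ k) →
                   ∀ {u l} (s′ : State u l) → ¬ Falsified s′ (stepMoves q)
    stepMoves-ok ((i , k , l) , j , j′) (i<k , l≤k) s′ falsified = contradiction l≤k (<⇒≱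
      (stepMoves-safe s′ (j , true′ (here refl) , true′ (there (here refl))) i<k
        (j′ , true′ (there (there (here refl))) , true′ (there (there (there (here refl)))))))
      where
      true′ : ∀ {w} → w ∈ pointer i j ∷ target i j k ∷ pointer k j′ ∷ target k j′ l ∷ [] → True s′ w
      true′ = all-true s′ (pointer i j ∷ target i j k ∷ pointer k j′ ∷ target k j′ l ∷ []) falsified

    OK : Clause variables → Set
    OK C = Unviolated parameters val val-separable s (clauseInequality C)
    pointers : ∀ i → OK (somePointer i)
    pointers i = clause-unviolated s (somePointer i) (somePointer-ok i)
    targets : ∀ q → OK (someTarget q)
    targets q = clause-unviolated s (someTarget q) (someTarget-ok q)
    starts : ∀ j → OK (startMoves j)
    starts j = clause-unviolated s (startMoves j) (startMoves-ok j)
    moves : ∀ q → (let (i , k , l) , _ = q in i Fin.< k × l Fin.≤ k) → OK (stepMoves q)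
    moves q b = clause-unviolated s (stepMoves q) (stepMoves-ok q b)

  depth-bound : ∀ L (π : SPRefutation formula) → depth π + L + 2 ≤ N →
    variables + (variables + length formula) + depth π ≤ 2 ^ L → ⊥
  depth-bound L π = resist parameters val val-separable L π initial (formula-unviolated initial)

-- Building refutations

n<2^n : ∀ n → n < 2 ^ n
n<2^n zero    = s≤s z≤n
n<2^n (suc n) = ≤-trans (+-mono-≤ (m^n>0 2 n) (n<2^n n)) (≤-reflexive (cong (_+_ (2 ^ n)) (sym (+-identityʳ (2 ^ n)))))

-- A linear estimate suffices, since only the sum of the weights in a leaf has to stay polynomial.
bitsℤ-≤ : ∀ z → bitsℤ z ≤ suc ℤ.∣ z ∣
bitsℤ-≤ z = s≤s (≤-trans (⌈log₂⌉-mono-≤ (n<2^n ℤ.∣ z ∣)) (≤-reflexive (⌈log₂2^n⌉≡n ℤ.∣ z ∣)))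

coprime-1 : ∀ w → Coprime w 1
coprime-1 w = Coprime.sym (Coprime.1-coprimeTo w)

fromℤ-nonNegative : ∀ w → ℚ.NonNegative (fromℤ (+ w))
fromℤ-nonNegative w rewrite ℚ.normalize-coprime (coprime-1 w) = _

bitsℚ-fromℤ : ∀ w → bitsℚ (fromℤ (+ w)) ≤ 3 + w
bitsℚ-fromℤ w rewrite ℚ.normalize-coprime (coprime-1 w) =
  ≤-trans (+-mono-≤ (bitsℤ-≤ (+ w)) (bitsℤ-≤ (+ 1))) (≤-reflexive (cong suc (+-comm w 2)))

module _ {v : ℕ} where

  -- A derivation of `f·x ≥ b` from `S`. Left-hand sides are functions, so that linear identities
  -- are checked coordinate by coordinate, and `cost` tracks the total weight that bounds the bits
  -- of a leaf.
  record Conical {M} (S : System v M) (f : Fin v → ℤ) (b : ℤ) (cost : ℕ) : Set where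
    constructor conical
    field
      weights     : Vec ℕ M
      coefficient : ∀ u → combine (λ e → lookup (coeffs e) u) weights S ≡ f u
      constant    : combine bound weights S ≡ b
      weight      : Vec.sum weights ≤ cost

  module _ {X : Set} where
    zeros : ∀ M → Vec ℕ M
    zeros M = Vec.replicate M 0

    combine-zeros : ∀ (g : X → ℤ) {M} (S : Vec X M) → combine g (zeros M) S ≡ 0ℤ
    combine-zeros g []      = refl
    combine-zeros g (e ∷ S) = trans (ℤ.+-identityˡ _) (combine-zeros g S)

    sum-zeros : ∀ M → Vec.sum (zeros M) ≡ 0
    sum-zeros zero    = refl
    sum-zeros (suc M) = sum-zeros M

    only : ∀ {M} {S : Vec X M} {e} → e ∈ᵥ S → Vec ℕ M
    only (here _)  = 1 ∷ zeros _
    only (there p) = 0 ∷ only p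

    combine-only : ∀ (g : X → ℤ) {M} {S : Vec X M} {e} (p : e ∈ᵥ S) → combine g (only p) S ≡ g e
    combine-only g {S = e ∷ S} (here refl) = trans (cong₂ ℤ._+_ (ℤ.*-identityˡ (g e)) (combine-zeros g S)) (ℤ.+-identityʳ (g e))
    combine-only g {S = e ∷ S} (there p)   = trans (ℤ.+-identityˡ _) (combine-only g p)

    sum-only : ∀ {M} {S : Vec X M} {e} (p : e ∈ᵥ S) → Vec.sum (only p) ≡ 1
    sum-only (here {n} _) = cong suc (sum-zeros n)
    sum-only (there p)    = sum-only p

    combine-zipWith : ∀ (g : X → ℤ) {M} (ws ws′ : Vec ℕ M) S →
                      combine g (Vec.zipWith _+_ ws ws′) S ≡ combine g ws S ℤ.+ combine g ws′ S
    combine-zipWith g []       []         []      = refl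
    combine-zipWith g (w ∷ ws) (w′ ∷ ws′) (e ∷ S) =
      trans (cong₂ (λ x y → x ℤ.* g e ℤ.+ y) (ℤ.pos-+ w w′) (combine-zipWith g ws ws′ S))
            (regroup (+ w) (+ w′) (g e) _ _)
      where
      regroup : ∀ w w′ x a b → (w ℤ.+ w′) ℤ.* x ℤ.+ (a ℤ.+ b) ≡ w ℤ.* x ℤ.+ a ℤ.+ (w′ ℤ.* x ℤ.+ b)
      regroup = ℤRing.solve-∀

  sum-zipWith : ∀ {M} (ws ws′ : Vec ℕ M) → Vec.sum (Vec.zipWith _+_ ws ws′) ≡ Vec.sum ws + Vec.sum ws′
  sum-zipWith []       []         = refl
  sum-zipWith (w ∷ ws) (w′ ∷ ws′) = trans (cong (_+_ (w + w′)) (sum-zipWith ws ws′)) (regroup w w′ _ _)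
    where
    regroup : ∀ w w′ a b → w + w′ + (a + b) ≡ w + a + (w′ + b)
    regroup = solve-∀

  module _ {M} {S : System v M} where

    axiom : ∀ {e f b} → e ∈ᵥ S → (∀ u → lookup (coeffs e) u ≡ f u) → bound e ≡ b → Conical S f b 1
    axiom e∈ f≡ b≡ = conical (only e∈) (λ u → trans (combine-only _ e∈) (f≡ u))
                             (trans (combine-only bound e∈) b≡) (≤-reflexive (sum-only e∈))

    add : ∀ {f g a b c d} → Conical S f a c → Conical S g b d → Conical S (λ u → f u ℤ.+ g u) (a ℤ.+ b) (c + d)
    add (conical ws p q r) (conical ws′ p′ q′ r′) = conical (Vec.zipWith _+_ ws ws′)
      (λ u → trans (combine-zipWith _ ws ws′ S) (cong₂ ℤ._+_ (p u) (p′ u)))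
      (trans (combine-zipWith bound ws ws′ S) (cong₂ ℤ._+_ q q′))
      (≤-trans (≤-reflexive (sum-zipWith ws ws′)) (+-mono-≤ r r′))

    relabel : ∀ {f g a b c d} → (∀ u → f u ≡ g u) → a ≡ b → c ≤ d → Conical S f a c → Conical S g b d
    relabel f≡g a≡b c≤d (conical ws p q r) = conical ws (λ u → trans (p u) (f≡g u)) (trans q a≡b) (≤-trans r c≤d)

    weaken : ∀ {e f b c} → Conical S f b c → Conical (e ∷ S) f b c
    weaken (conical ws p q r) = conical (0 ∷ ws) (λ u → trans (ℤ.+-identityˡ _) (p u)) (trans (ℤ.+-identityˡ _) q) r

    addAll : ∀ r {f : Fin r → Fin v → ℤ} {c} → (∀ l → Conical S (f l) 0ℤ c) →
             Conical S (λ u → ℤ∑.sum (λ l → f l u)) 0ℤ (r * c)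
    addAll zero    _  = conical (zeros {Inequality v} M) (λ u → combine-zeros _ S) (combine-zeros bound S)
                                (≤-reflexive (sum-zeros {Inequality v} M))
    addAll (suc r) Fs = add (Fs zero) (addAll r (Fs ∘ suc))

  Refutation : ∀ {M} → System v M → ℕ → Set
  Refutation S s = Σ[ π ∈ SP S ] size π ≤ s

  close : ∀ {M} {S : System v M} {f b c} → Conical S f b c → (∀ u → f u ≡ 0ℤ) → b ≡ 1ℤ → Refutation S (1 + (3 * M + c))
  close {M} {S} (conical ws p q r) f≡0 b≡1 = leaf record
    { ws          = Vec.map (fromℤ ∘ +_) ws
    ; nonNegative = nonNegative ws
    ; lhs≡0       = λ u → trans (fromℤ-combine (λ e → lookup (coeffs e) u) ws S) (cong fromℤ (trans (p u) (f≡0 u)))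
    ; rhs≡1       = trans (fromℤ-combine bound ws S) (cong fromℤ (trans q b≡1))
    } , s≤s (≤-trans (bits ws) (+-monoʳ-≤ (3 * M) r))
    where
    nonNegative : ∀ {M} (ws : Vec ℕ M) → All ℚ.NonNegative (Vec.map (fromℤ ∘ +_) ws)
    nonNegative []       = []
    nonNegative (w ∷ ws) = fromℤ-nonNegative w ∷ nonNegative ws
    bits : ∀ {M} (ws : Vec ℕ M) → Vec.sum (Vec.map bitsℚ (Vec.map (fromℤ ∘ +_) ws)) ≤ 3 * M + Vec.sum ws
    bits []                 = z≤n
    bits {suc M} (w ∷ ws)   = ≤-trans (+-mono-≤ (bitsℚ-fromℤ w) (bits ws)) (≤-reflexive (regroup w M (Vec.sum ws)))
      where
      regroup : ∀ w M s → 3 + w + (3 * M + s) ≡ 3 * suc M + (w + s)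
      regroup = solve-∀

  indicator : List (Fin v) → Vec ℤ v
  indicator vs = Vec.tabulate λ u → + multiplicity vs u

  lookup-indicator : ∀ vs u → lookup (indicator vs) u ≡ + multiplicity vs u
  lookup-indicator vs u = lookup∘tabulate (λ u → + multiplicity vs u) u

  lookup-negated : ∀ vs u → lookup (Vec.map ℤ.-_ (indicator vs)) u ≡ ℤ.- + multiplicity vs u
  lookup-negated vs u = trans (lookup-map u ℤ.-_ (indicator vs)) (cong ℤ.-_ (lookup-indicator vs u))

  multiplicity≤length : ∀ vs (u : Fin v) → multiplicity vs u ≤ length vs
  multiplicity≤length []       u = z≤n
  multiplicity≤length (i ∷ vs) u = +-mono-≤ (⟦⟧≤1 (does (u Fin.≟ i))) (multiplicity≤length vs u)

  bitsInequality-≤ : ∀ {c} (e : Inequality v) → (∀ u → bitsℤ (lookup (coeffs e) u) ≤ c) → bitsℤ (bound e) ≤ c →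
                     bitsInequality e ≤ v * c + c
  bitsInequality-≤ {c} (cs ≥′ d) cs≤ d≤ = +-mono-≤ (go cs cs≤) d≤
    where
    go : ∀ {w} (cs : Vec ℤ w) → (∀ u → bitsℤ (lookup cs u) ≤ c) → Vec.sum (Vec.map bitsℤ cs) ≤ w * c
    go []       _   = z≤n
    go (z ∷ cs) cs≤ = +-mono-≤ (cs≤ zero) (go cs (cs≤ ∘ suc))

  -- The node and its two edge labels, each with v coefficients and a bound of at most three bits.
  branch : ℕ
  branch = 1 + 2 * (v * 3 + 3)

  cut : ∀ {M} {S : System v M} vs d {a b} → length vs ≤ 2 → d ≤ 1 →
        Refutation ((indicator vs ≤′ + suc d ℤ.- 1ℤ) ∷ S) a →
        Refutation ((indicator vs ≥′ + suc d) ∷ S) b → Refutation S (branch + a + b)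
  cut vs d {a} {b} short d≤1 (π , π≤) (ρ , ρ≤) = node (indicator vs) (+ suc d) π ρ , s≤s (≤-trans
    (+-mono-≤ (+-mono-≤ low π≤) (+-mono-≤ high ρ≤)) (≤-reflexive (regroup (v * 3 + 3) a b)))
    where
    regroup : ∀ w a b → w + a + (w + b) ≡ 2 * w + a + b
    regroup = solve-∀
    bits≤3 : ∀ z → ℤ.∣ z ∣ ≤ 2 → bitsℤ z ≤ 3
    bits≤3 z z≤2 = ≤-trans (bitsℤ-≤ z) (s≤s z≤2)
    mult≤2 : ∀ u → multiplicity vs u ≤ 2
    mult≤2 u = ≤-trans (multiplicity≤length vs u) short
    low : bitsInequality (indicator vs ≤′ + suc d ℤ.- 1ℤ) ≤ v * 3 + 3
    low = bitsInequality-≤ (indicator vs ≤′ + suc d ℤ.- 1ℤ)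
      (λ u → bits≤3 (lookup (Vec.map ℤ.-_ (indicator vs)) u) (subst (λ z → ℤ.∣ z ∣ ≤ 2) (sym (lookup-negated vs u))
        (≤-trans (≤-reflexive (ℤ.∣-i∣≡∣i∣ (+ multiplicity vs u))) (mult≤2 u))))
      (bits≤3 (ℤ.- + d) (≤-trans (≤-reflexive (ℤ.∣-i∣≡∣i∣ (+ d))) (≤-trans d≤1 (s≤s z≤n))))
    high : bitsInequality (indicator vs ≥′ + suc d) ≤ v * 3 + 3
    high = bitsInequality-≤ (indicator vs ≥′ + suc d)
      (λ u → bits≤3 (lookup (indicator vs) u) (subst (λ z → ℤ.∣ z ∣ ≤ 2) (sym (lookup-indicator vs u)) (mult≤2 u)))
      (bits≤3 (+ suc d) (s≤s d≤1))

  -- Extension of systems in terms of derivability: what was derived higher in the tree stays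
  -- available below.
  _⊴_ : ∀ {M M′} → System v M → System v M′ → Set
  S ⊴ S′ = ∀ {f b c} → Conical S f b c → Conical S′ f b c

  -- Builds the caterpillar. Each branch asserting that the variables of `vs j` sum to at least
  -- `suc d` is closed by `side`; the spine collects the opposite inequalities and hands all of them
  -- to `main`.
  cutAll : ∀ {J : Set} (vs : J → List (Fin v)) d → (∀ j → length (vs j) ≤ 2) → d ≤ 1 → ∀ js {M} {S : System v M} {a b} →
    (∀ {j} → j ∈ js → ∀ {M′} {S′ : System v M′} → S ⊴ S′ → M′ ≤ M + length js →
       Refutation ((indicator (vs j) ≥′ + suc d) ∷ S′) a) →
    (∀ {M′} {S′ : System v M′} → S ⊴ S′ → M′ ≤ M + length js →
       (∀ {j} → j ∈ js → Conical S′ (λ u → ℤ.- + multiplicity (vs j) u) (ℤ.- + d) 1) → Refutation S′ b) →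
    Refutation S (length js * (branch + a) + b)
  cutAll vs d short d≤1 []       side main = main id (≤-reflexive (sym (+-identityʳ _))) λ ()
  cutAll vs d short d≤1 (j ∷ js) {M} {S} {a} {b} side main
    with π , π≤ ← cut {S = S} (vs j) d (short j) d≤1
      (cutAll vs d short d≤1 js
        (λ j∈ ext M′≤ → side (there j∈) (λ F → ext (weaken F)) (≤-trans M′≤ (≤-reflexive (sym (+-suc M _)))))
        (λ ext M′≤ known → main (λ F → ext (weaken F)) (≤-trans M′≤ (≤-reflexive (sym (+-suc M _))))
           λ { (here refl) → ext (axiom (here refl) (lookup-negated (vs j)) refl)
             ; (there j∈)  → known j∈ }))
      (side (here refl) id (m≤m+n M _))
    = π , ≤-trans π≤ (≤-reflexive (regroup branch a b (length js)))
    where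
    regroup : ∀ w a b l → w + (l * (w + a) + b) + a ≡ suc l * (w + a) + b
    regroup = solve-∀

-- Refuting the formula

length-cartesianProduct : ∀ {A B : Set} (xs : List A) (ys : List B) →
                          length (List.cartesianProduct xs ys) ≡ length xs * length ys
length-cartesianProduct []       ys = refl
length-cartesianProduct (x ∷ xs) ys = trans (length-++ (List.map (x ,_) ys))
  (cong₂ _+_ (length-map (x ,_) ys) (length-cartesianProduct xs ys))

multiplicity-tabulate : ∀ {v r} (f : Fin r → Fin v) u →
                        + multiplicity (List.tabulate f) u ≡ ℤ∑.sum (λ l → + δ (f l) u)
multiplicity-tabulate {r = zero}  f u = refl
multiplicity-tabulate {r = suc r} f u = trans (ℤ.pos-+ (δ (f zero) u) _)
  (cong (ℤ._+_ (+ δ (f zero) u)) (multiplicity-tabulate (f ∘ suc) u))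

sum-cancel : ∀ {r} (f g : Fin r → ℤ) → (∀ l → f l ≡ ℤ.- g l) → ∀ {s} → s ≡ ℤ∑.sum g → ℤ∑.sum f ℤ.+ s ≡ 0ℤ
sum-cancel f g f≡-g refl = go f g f≡-g
  where
  regroup : ∀ x s y → ℤ.- y ℤ.+ s ℤ.+ (y ℤ.+ x) ≡ s ℤ.+ x
  regroup = ℤRing.solve-∀
  go : ∀ {r} (f g : Fin r → ℤ) → (∀ l → f l ≡ ℤ.- g l) → ℤ∑.sum f ℤ.+ ℤ∑.sum g ≡ 0ℤ
  go {zero}  f g f≡-g = refl
  go {suc r} f g f≡-g = trans (cong (λ x → x ℤ.+ ℤ∑.sum (f ∘ suc) ℤ.+ ℤ∑.sum g) (f≡-g zero))
    (trans (regroup (ℤ∑.sum (g ∘ suc)) (ℤ∑.sum (f ∘ suc)) (g zero)) (go (f ∘ suc) (g ∘ suc) (f≡-g ∘ suc)))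

module _ (n m : ℕ) where

  open Formula n m

  private
    v : ℕ
    v = variables

  pointer-injective : ∀ i j i′ j′ → pointer i j ≡ pointer i′ j′ → (i , j) ≡ (i′ , j′)
  pointer-injective i j i′ j′ eq =
    inj₁-injective (trans (sym (decode-pointer i j)) (trans (cong decode eq) (decode-pointer i′ j′)))

  target-injective : ∀ i j k i′ j′ k′ → target i j k ≡ target i′ j′ k′ → (i , j , k) ≡ (i′ , j′ , k′)
  target-injective i j k i′ j′ k′ eq =
    inj₂-injective (trans (sym (decode-target i j k)) (trans (cong decode eq) (decode-target i′ j′ k′)))

  pointer≢target : ∀ i j i′ j′ k′ → pointer i j ≢ target i′ j′ k′
  pointer≢target i j i′ j′ k′ eq
    with () ← trans (sym (decode-pointer i j)) (trans (cong decode eq) (decode-target i′ j′ k′))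

  Neg : List (Fin v) → Fin v → ℤ
  Neg vs u = ℤ.- + multiplicity vs u

  Pos : List (Fin v) → Fin v → ℤ
  Pos vs u = + multiplicity vs u

  -- `k` descends from `N`: `unpointed` says that nodes numbered `k` or more have already been shown
  -- to have no lower node pointing at them, so it is vacuous at the start.
  record Env {M} (S : System v M) (k : ℕ) : Set where
    field
      some-pointer : ∀ i → Conical S (Pos (List.tabulate (pointer i))) 1ℤ 1
      some-target  : ∀ i j → Conical S (Pos (List.tabulate (target i j))) 1ℤ 1
      start        : ∀ j → Conical S (Neg (pointer zero j ∷ target zero j zero ∷ [])) -1ℤ 1
      step         : ∀ i κ l j j′ → i Fin.< κ → l Fin.≤ κ →
                     Conical S (Neg (pointer i j ∷ target i j κ ∷ pointer κ j′ ∷ target κ j′ l ∷ [])) (ℤ.- + 3) 1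
      unpointed    : ∀ i l j → k ≤ toℕ l → i Fin.< l → Conical S (Neg (pointer i j ∷ target i j l ∷ [])) -1ℤ 1

  open Env

  lift : ∀ {M M′} {S : System v M} {S′ : System v M′} {k} → S ⊴ S′ → Env S k → Env S′ k
  lift ext E = record
    { some-pointer = λ i → ext (some-pointer E i)
    ; some-target  = λ i j → ext (some-target E i j)
    ; start        = λ j → ext (start E j)
    ; step         = λ i κ l j j′ i<κ l≤κ → ext (step E i κ l j j′ i<κ l≤κ)
    ; unpointed    = λ i l j k≤l i<l → ext (unpointed E i l j k≤l i<l)
    }

  initialEnv : Env (encode formula) N
  initialEnv = record
    { some-pointer = λ i → positive (List.tabulate (pointer i))
        (Unique.tabulate⁺ λ {j} {j′} eq → cong proj₂ (pointer-injective i j i j′ eq))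
        (∈-++⁺ˡ (∈-map⁺ somePointer (∈-allFin i)))
    ; some-target  = λ i j → positive (List.tabulate (target i j))
        (Unique.tabulate⁺ λ {l} {l′} eq → cong (proj₂ ∘ proj₂) (target-injective i j l i j l′ eq))
        (∈-++⁺ʳ pointerClauses (∈-++⁺ˡ (∈-map⁺ someTarget (∈-cartesianProduct⁺ (∈-allFin i) (∈-allFin j)))))
    ; start        = λ j → negative (pointer zero j ∷ target zero j zero ∷ [])
        ((pointer≢target zero j zero j zero ∷ []) ∷ [] ∷ [])
        (∈-++⁺ʳ pointerClauses (∈-++⁺ʳ targetClauses (∈-++⁺ˡ (∈-map⁺ startMoves (∈-allFin j)))))
    ; step         = λ i κ l j j′ i<κ l≤κ →
        negative (pointer i j ∷ target i j κ ∷ pointer κ j′ ∷ target κ j′ l ∷ [])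
          (distinct i κ l j j′ λ { refl → <-irrefl refl i<κ })
          (∈-++⁺ʳ pointerClauses (∈-++⁺ʳ targetClauses (∈-++⁺ʳ startClauses
            (∈-map⁺ stepMoves (∈-filter⁺ blocked? {x = (i , κ , l) , j , j′} (∈-steps i κ l j j′) (i<κ , l≤κ))))))
    ; unpointed    = λ _ l _ N≤l _ → contradiction N≤l (<⇒≱ (Fin.toℕ<n l))
    }
    where
    ∈-steps : ∀ i κ l j j′ → ((i , κ , l) , j , j′) ∈ steps
    ∈-steps i κ l j j′ = ∈-cartesianProduct⁺
      (∈-cartesianProduct⁺ (∈-allFin i) (∈-cartesianProduct⁺ (∈-allFin κ) (∈-allFin l)))
      (∈-cartesianProduct⁺ (∈-allFin j) (∈-allFin j′))
    distinct : ∀ i κ l j j′ → i ≢ κ → Unique (pointer i j ∷ target i j κ ∷ pointer κ j′ ∷ target κ j′ l ∷ [])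
    distinct i κ l j j′ i≢κ =
      (pointer≢target i j i j κ ∷ (λ eq → i≢κ (cong proj₁ (pointer-injective i j κ j′ eq))) ∷ pointer≢target i j κ j′ l ∷ []) ∷
      ((λ eq → pointer≢target κ j′ i j κ (sym eq)) ∷ (λ eq → i≢κ (cong proj₁ (target-injective i j κ κ j′ l eq))) ∷ []) ∷
      (pointer≢target κ j′ κ j′ l ∷ []) ∷ [] ∷ []
    clause∈ : ∀ {C} → C ∈ formula → clauseInequality C ∈ᵥ encode formula
    clause∈ C∈ = Vec.∈-++⁺ʳ (Vec.tabulate λ i → unit i ≥′ 0ℤ) (Vec.∈-++⁺ʳ (Vec.tabulate λ i → unit i ≤′ 1ℤ)
                   (Vec.∈-map⁺ clauseInequality (∈-fromList⁺ C∈)))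
    positive : ∀ vs → Unique vs → disjunction vs [] ∈ formula → Conical (encode formula) (Pos vs) 1ℤ 1
    positive vs uniq C∈ = axiom (clause∈ C∈)
      (λ u → trans (disjunction-coefficient uniq [] u) (ℤ.+-identityʳ (Pos vs u)))
      (disjunction-bound {ps = vs} {qs = []} [])
    negative : ∀ vs → Unique vs → disjunction [] vs ∈ formula → Conical (encode formula) (Neg vs) (1ℤ ℤ.- + length vs) 1
    negative vs uniq C∈ = axiom (clause∈ C∈)
      (λ u → trans (disjunction-coefficient [] uniq u) (ℤ.+-identityˡ (Neg vs u)))
      (disjunction-bound {ps = []} {qs = vs} uniq)

  module Bounds (Lmax : ℕ) where

    -- `Lmax` bounds the number of inequalities available at any leaf, so one size serves all
    -- leaves; `N * 3 + m + 1` covers the weights of both kinds of leaf.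
    leafSize reachedSize : ℕ
    leafSize = 1 + (3 * Lmax + (N * 3 + m + 1))
    reachedSize = m * (branch {v} + leafSize) + leafSize

    leafSize-≤ : ∀ {M c} → M ≤ Lmax → c ≤ N * 3 + m + 1 → ∀ {S : System v M} → Refutation S (1 + (3 * M + c)) → Refutation S leafSize
    leafSize-≤ M≤ c≤ (π , π≤) = π , ≤-trans π≤ (s≤s (+-mono-≤ (*-monoʳ-≤ 3 M≤) c≤))

    -- A node with every value blocked is contradictory. A selected slot would have no possible
    -- target, so no slot can be selected, against `some-pointer`.
    reached : ∀ {M} {S : System v M} {k} κ → M + suc m ≤ Lmax → Env S k →
              (∀ j l → Conical S (Neg (pointer κ j ∷ target κ j l ∷ [])) -1ℤ 2) → Refutation S reachedSize
    reached {M} {S} κ M≤ E blocked = subst (λ r → Refutation S (r * (branch {v} + leafSize) + leafSize)) (length-tabulate {n = m} id)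
      (cutAll (λ j → pointer κ j ∷ []) 0 (λ _ → s≤s z≤n) z≤n (List.allFin m) side main)
      where
      within : ∀ {M′} → M′ ≤ M + length (List.allFin m) → suc M′ ≤ Lmax
      within M′≤ = ≤-trans (s≤s M′≤) (≤-trans (≤-reflexive (trans (cong (λ r → suc (M + r)) (length-tabulate {n = m} id)) (sym (+-suc M m)))) M≤)
      side : ∀ {j} → j ∈ List.allFin m → ∀ {M′} {S′ : System v M′} → S ⊴ S′ → M′ ≤ M + length (List.allFin m) →
             Refutation ((indicator (pointer κ j ∷ []) ≥′ + 1) ∷ S′) leafSize
      -- For each `l` the blocked pair together with the asserted pointer leaves `target κ j l` at
      -- most 0; the sum over `l` contradicts `some-target`.
      side {j} _ {M′} {S′} ext M′≤ = leafSize-≤ (within M′≤) (+-monoˡ-≤ 1 (m≤m+n (N * 3) m))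
        (close (add (addAll N λ l → add (weaken (ext (blocked j l))) asserted) (weaken (ext (some-target E κ j)))) vanish refl)
        where
        asserted : Conical ((indicator (pointer κ j ∷ []) ≥′ + 1) ∷ S′) (Pos (pointer κ j ∷ [])) 1ℤ 1
        asserted = axiom (here refl) (lookup-indicator (pointer κ j ∷ [])) refl
        p : Fin v → ℤ
        p u = + δ (pointer κ j) u
        vanish : ∀ u → ℤ∑.sum (λ l → Neg (pointer κ j ∷ target κ j l ∷ []) u ℤ.+ Pos (pointer κ j ∷ []) u)
                       ℤ.+ Pos (List.tabulate (target κ j)) u ≡ 0ℤ
        vanish u = sum-cancel _ (λ l → + δ (target κ j l) u) (λ l → shape (δ (pointer κ j) u) (δ (target κ j l) u))
                     (multiplicity-tabulate (target κ j) u)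
          where
          ring : ∀ a b → ℤ.- (a ℤ.+ (b ℤ.+ 0ℤ)) ℤ.+ (a ℤ.+ 0ℤ) ≡ ℤ.- b
          ring = ℤRing.solve-∀
          shape : ∀ a b → ℤ.- + (a + (b + 0)) ℤ.+ + (a + 0) ≡ ℤ.- + b
          shape a b = ring (+ a) (+ b)
      main : ∀ {M′} {S′ : System v M′} → S ⊴ S′ → M′ ≤ M + length (List.allFin m) →
             (∀ {j} → j ∈ List.allFin m → Conical S′ (Neg (pointer κ j ∷ [])) 0ℤ 1) → Refutation S′ leafSize
      main {M′} {S′} ext M′≤ known = leafSize-≤ (<⇒≤ (within M′≤))
        (+-monoˡ-≤ 1 (≤-trans (≤-reflexive (*-identityʳ m)) (m≤n+m m (N * 3))))
        (close (add (addAll m λ j → known (∈-allFin j)) (ext (some-pointer E κ))) vanish refl)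
        where
        vanish : ∀ u → ℤ∑.sum (λ j → Neg (pointer κ j ∷ []) u) ℤ.+ Pos (List.tabulate (pointer κ)) u ≡ 0ℤ
        vanish u = sum-cancel _ (λ j → + δ (pointer κ j) u)
          (λ j → cong (λ x → ℤ.- + x) (+-identityʳ (δ (pointer κ j) u)))
          (multiplicity-tabulate (pointer κ) u)

    refutationSize : ℕ → ℕ
    refutationSize k = k * (N * m * (branch {v} + reachedSize)) + reachedSize

    -- If some lower node pointed to `κ`, the step clauses would block all values of `κ` up to `κ`
    -- and `unpointed` all larger ones, so `reached` closes the branch. At stage 0 the start clauses
    -- and `unpointed` block all values of node 0.
    refute : ∀ k {M} {S : System v M} → k ≤ N → M + k * (N * m) + (2 + m) ≤ Lmax → Env S k → Refutation S (refutationSize k)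
    refute zero {M} {S} _ M≤ E = reached zero
      (≤-trans (+-mono-≤ (m≤m+n M 0) (n≤1+n (suc m))) M≤) E blocked
      where
      blocked : ∀ j l → Conical S (Neg (pointer zero j ∷ target zero j l ∷ [])) -1ℤ 2
      blocked j zero    = relabel (λ _ → refl) refl (s≤s z≤n) (start E j)
      blocked j (suc l) = relabel (λ _ → refl) refl (s≤s z≤n) (unpointed E zero (suc l) j z≤n (s≤s z≤n))
    refute (suc k) {M} {S} k<N M≤ E = map₂ (λ π≤ → ≤-trans π≤ size≤)
      (cutAll vars₂ 1 (λ _ → ≤-refl) ≤-refl pairs side main)
      where
      κ : Fin N
      κ = Fin.fromℕ< k<N
      κ≡k : toℕ κ ≡ k
      κ≡k = Fin.toℕ-fromℕ< k<N
      pairs : List (Fin N × Fin m)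
      pairs = List.filter (λ q → proj₁ q Fin.<? κ) (List.cartesianProduct (List.allFin N) (List.allFin m))
      vars₂ : Fin N × Fin m → List (Fin v)
      vars₂ (i , j) = pointer i j ∷ target i j κ ∷ []
      few : length pairs ≤ N * m
      few = ≤-trans (length-filter _ (List.cartesianProduct (List.allFin N) (List.allFin m)))
        (≤-reflexive (trans (length-cartesianProduct (List.allFin N) (List.allFin m))
                            (cong₂ _*_ (length-tabulate {n = N} id) (length-tabulate {n = m} id))))
      size≤ : length pairs * (branch {v} + reachedSize) + refutationSize k ≤ refutationSize (suc k)
      size≤ = ≤-trans (+-monoˡ-≤ (refutationSize k) (*-monoˡ-≤ (branch {v} + reachedSize) few))
        (≤-reflexive (sym (+-assoc (N * m * (branch {v} + reachedSize)) (k * (N * m * (branch {v} + reachedSize))) reachedSize)))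
      grown : ∀ {M′} → M′ ≤ M + length pairs → M′ + k * (N * m) + (2 + m) ≤ Lmax
      grown {M′} M′≤ = ≤-trans (+-monoˡ-≤ (2 + m) (+-monoˡ-≤ (k * (N * m)) (≤-trans M′≤ (+-monoʳ-≤ M few))))
        (≤-trans (≤-reflexive (cong (_+ (2 + m)) (+-assoc M (N * m) (k * (N * m))))) M≤)
      side : ∀ {q} → q ∈ pairs → ∀ {M′} {S′ : System v M′} → S ⊴ S′ → M′ ≤ M + length pairs →
             Refutation ((indicator (vars₂ q) ≥′ + 2) ∷ S′) reachedSize
      side {i , j} q∈ {M′} {S′} ext M′≤ = reached κ
        (≤-trans (≤-reflexive (sym (+-suc M′ (suc m)))) (≤-trans (+-monoˡ-≤ (2 + m) (m≤m+n M′ _)) (grown M′≤)))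
        (lift (λ F → weaken (ext F)) E) blocked
        where
        i<κ : i Fin.< κ
        i<κ = proj₂ (∈-filter⁻ (λ q → proj₁ q Fin.<? κ) {xs = List.cartesianProduct (List.allFin N) (List.allFin m)} q∈)
        ring : ∀ a b c d → ℤ.- (a ℤ.+ (b ℤ.+ (c ℤ.+ (d ℤ.+ 0ℤ)))) ℤ.+ (a ℤ.+ (b ℤ.+ 0ℤ)) ≡ ℤ.- (c ℤ.+ (d ℤ.+ 0ℤ))
        ring = ℤRing.solve-∀
        shape : ∀ a b c d → ℤ.- + (a + (b + (c + (d + 0)))) ℤ.+ + (a + (b + 0)) ≡ ℤ.- + (c + (d + 0))
        shape a b c d = ring (+ a) (+ b) (+ c) (+ d)
        blocked : ∀ j′ l → Conical ((indicator (vars₂ (i , j)) ≥′ + 2) ∷ S′) (Neg (pointer κ j′ ∷ target κ j′ l ∷ [])) -1ℤ 2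
        blocked j′ l with l Fin.≤? κ
        -- Four literals summing to at most 3, of which the first two sum to at least 2, leave at
        -- most 1 for the others.
        ... | yes l≤κ = relabel
          (λ u → shape (δ (pointer i j) u) (δ (target i j κ) u) (δ (pointer κ j′) u) (δ (target κ j′ l) u)) refl ≤-refl
          (add (weaken (ext (step E i κ l j j′ i<κ l≤κ))) (axiom (here refl) (lookup-indicator (vars₂ (i , j))) refl))
        ... | no l≰κ  = relabel (λ _ → refl) refl (s≤s z≤n)
          (weaken (ext (unpointed E κ l j′ (subst (_< toℕ l) κ≡k (≰⇒> l≰κ)) (≰⇒> l≰κ))))
      main : ∀ {M′} {S′ : System v M′} → S ⊴ S′ → M′ ≤ M + length pairs →
             (∀ {q} → q ∈ pairs → Conical S′ (Neg (vars₂ q)) -1ℤ 1) → Refutation S′ (refutationSize k)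
      main {M′} {S′} ext M′≤ known = refute k (<⇒≤ k<N) (grown M′≤) record
        { some-pointer = some-pointer E′
        ; some-target  = some-target E′
        ; start        = start E′
        ; step         = step E′
        ; unpointed    = unpointed′
        }
        where
        E′ : Env S′ (suc k)
        E′ = lift ext E
        unpointed′ : ∀ i l j → k ≤ toℕ l → i Fin.< l → Conical S′ (Neg (pointer i j ∷ target i j l ∷ [])) -1ℤ 1
        unpointed′ i l j k≤l i<l with l Fin.≟ κ
        ... | yes refl = known (∈-filter⁺ (λ q → proj₁ q Fin.<? κ) {x = i , j} (∈-cartesianProduct⁺ (∈-allFin i) (∈-allFin j)) i<l)
        ... | no l≢κ   = unpointed E′ i l j
          (≤∧≢⇒< k≤l λ k≡l → l≢κ (Fin.toℕ-injective (trans (sym k≡l) (sym κ≡k)))) i<l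

  formulaLength : length formula ≤ N + (N * m + (m + N * (N * N) * (m * m)))
  formulaLength = ≤-trans
    (≤-reflexive (trans (length-++ pointerClauses) (cong₂ _+_ pointers
      (trans (length-++ targetClauses) (cong₂ _+_ targets
        (trans (length-++ startClauses) (cong₂ _+_ starts (length-map stepMoves (List.filter blocked? steps)))))))))
    (+-monoʳ-≤ N (+-monoʳ-≤ (N * m) (+-monoʳ-≤ m (≤-trans (length-filter blocked? steps) (≤-reflexive steps-length)))))
    where
    fin² : ∀ a b → length (List.cartesianProduct (List.allFin a) (List.allFin b)) ≡ a * b
    fin² a b = trans (length-cartesianProduct (List.allFin a) (List.allFin b))
                     (cong₂ _*_ (length-tabulate {n = a} id) (length-tabulate {n = b} id))
    pointers : length pointerClauses ≡ N
    pointers = trans (length-map somePointer (List.allFin N)) (length-tabulate {n = N} id)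
    targets : length targetClauses ≡ N * m
    targets = trans (length-map someTarget (List.cartesianProduct (List.allFin N) (List.allFin m))) (fin² N m)
    starts : length startClauses ≡ m
    starts = trans (length-map startMoves (List.allFin m)) (length-tabulate {n = m} id)
    triples : List (Fin N × Fin N × Fin N)
    triples = List.cartesianProduct (List.allFin N) (List.cartesianProduct (List.allFin N) (List.allFin N))
    steps-length : length steps ≡ N * (N * N) * (m * m)
    steps-length = trans (length-cartesianProduct triples (List.cartesianProduct (List.allFin m) (List.allFin m)))
      (cong₂ _*_ (trans (length-cartesianProduct (List.allFin N) (List.cartesianProduct (List.allFin N) (List.allFin N)))
                        (cong₂ _*_ (length-tabulate {n = N} id) (fin² N N)))
                 (fin² m m))

-- Polynomial bounds

-- The base `suc n` is never 0, so raising the exponent never hurts.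
Polynomial : (ℕ → ℕ) → Set
Polynomial f = ∃[ C ] ∃[ k ] ∀ n → f n ≤ C * suc n ^ k

module _ {f g : ℕ → ℕ} where

  polynomial-≤ : (∀ n → f n ≤ g n) → Polynomial g → Polynomial f
  polynomial-≤ f≤g (C , k , g≤) = C , k , λ n → ≤-trans (f≤g n) (g≤ n)

  polynomial-+ : Polynomial f → Polynomial g → Polynomial (λ n → f n + g n)
  polynomial-+ (C , k , f≤) (C′ , k′ , g≤) = C + C′ , k + k′ , λ n → begin
    f n + g n                                       ≤⟨ +-mono-≤ (f≤ n) (g≤ n) ⟩
    C * suc n ^ k + C′ * suc n ^ k′                 ≤⟨ +-mono-≤ (*-monoʳ-≤ C (^-monoʳ-≤ (suc n) (m≤m+n k k′)))
                                                                (*-monoʳ-≤ C′ (^-monoʳ-≤ (suc n) (m≤n+m k′ k))) ⟩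
    C * suc n ^ (k + k′) + C′ * suc n ^ (k + k′)    ≡⟨ *-distribʳ-+ (suc n ^ (k + k′)) C C′ ⟨
    (C + C′) * suc n ^ (k + k′)                     ∎
    where open ≤-Reasoning

  polynomial-* : Polynomial f → Polynomial g → Polynomial (λ n → f n * g n)
  polynomial-* (C , k , f≤) (C′ , k′ , g≤) = C * C′ , k + k′ , λ n → begin
    f n * g n                                       ≤⟨ *-mono-≤ (f≤ n) (g≤ n) ⟩
    C * suc n ^ k * (C′ * suc n ^ k′)               ≡⟨ regroup C (suc n ^ k) C′ (suc n ^ k′) ⟩
    C * C′ * (suc n ^ k * suc n ^ k′)               ≡⟨ cong (C * C′ *_) (^-distribˡ-+-* (suc n) k k′) ⟨
    C * C′ * suc n ^ (k + k′)                       ∎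
    where
    open ≤-Reasoning
    regroup : ∀ a b c d → a * b * (c * d) ≡ a * c * (b * d)
    regroup = solve-∀

polynomial-const : ∀ c → Polynomial (const c)
polynomial-const c = c , 0 , λ _ → ≤-reflexive (sym (*-identityʳ c))

polynomial-id : Polynomial id
polynomial-id = 1 , 1 , λ n → ≤-trans (n≤1+n n) (≤-reflexive (sym (trans (*-identityˡ _) (*-identityʳ (suc n)))))

[m*n]^k≡m^k*n^k : ∀ m n k → (m * n) ^ k ≡ m ^ k * n ^ k
[m*n]^k≡m^k*n^k m n zero    = refl
[m*n]^k≡m^k*n^k m n (suc k) = trans (cong (m * n *_) ([m*n]^k≡m^k*n^k m n k)) (regroup m n (m ^ k) (n ^ k))
  where
  regroup : ∀ m n a b → m * n * (a * b) ≡ m * a * (n * b)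
  regroup = solve-∀

polynomial⇒ : ∀ {f} → Polynomial f → ∃[ C ] ∃[ k ] ∀ n → f n ≤ C * n ^ k + C
polynomial⇒ {f} (C , k , f≤) = C * 2 ^ k , k , λ n → ≤-trans (f≤ n) (shift n)
  where
  shift : ∀ n → C * suc n ^ k ≤ C * 2 ^ k * n ^ k + C * 2 ^ k
  shift zero    = ≤-trans (*-monoʳ-≤ C (^-monoˡ-≤ k (s≤s z≤n))) (m≤n+m (C * 2 ^ k) _)
  shift (suc n) = ≤-trans (*-monoʳ-≤ C (begin
    suc (suc n) ^ k       ≤⟨ ^-monoˡ-≤ k (s≤s (≤-trans (m≤n+m (suc n) n) (≤-reflexive (cong (_+_ n) (sym (+-identityʳ (suc n))))))) ⟩
    (2 * suc n) ^ k       ≡⟨ [m*n]^k≡m^k*n^k 2 (suc n) k ⟩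
    2 ^ k * suc n ^ k     ∎)) (≤-trans (≤-reflexive (sym (*-assoc C (2 ^ k) _))) (m≤m+n _ _))
    where open ≤-Reasoning

-- Bernoulli's inequality `(1 + 1 / n) ^ k ≥ 1 + k / n` with denominators cleared.
bernoulli : ∀ n k → n ^ k * (n + k) ≤ n * suc n ^ k
bernoulli n zero    = ≤-reflexive (trans (*-identityˡ (n + 0)) (trans (+-identityʳ n) (sym (*-identityʳ n))))
bernoulli n (suc k) = begin
  n * n ^ k * (n + suc k)            ≤⟨ m≤m+n _ (n ^ k * k) ⟩
  n * n ^ k * (n + suc k) + n ^ k * k ≡⟨ regroup n (n ^ k) k ⟩
  suc n * (n ^ k * (n + k))          ≤⟨ *-monoʳ-≤ (suc n) (bernoulli n k) ⟩
  suc n * (n * suc n ^ k)            ≡⟨ swap (suc n) n (suc n ^ k) ⟩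
  n * suc n ^ suc k                  ∎
  where
  open ≤-Reasoning
  regroup : ∀ n p k → n * p * (n + suc k) + p * k ≡ suc n * (p * (n + k))
  regroup = solve-∀
  swap : ∀ a b c → a * (b * c) ≡ b * (a * c)
  swap = solve-∀

2*n^n≤[1+n]^n : ∀ n .{{_ : NonZero n}} → 2 * n ^ n ≤ suc n ^ n
2*n^n≤[1+n]^n n = *-cancelˡ-≤ n (≤-trans (≤-reflexive (regroup n (n ^ n))) (bernoulli n n))
  where
  regroup : ∀ n p → n * (2 * p) ≡ p * (n + n)
  regroup = solve-∀

module _ (n : ℕ) (9≤n : 9 ≤ n) where

  private
    -- `D` is `n` times `s` because `(N / n) ^ n` is at least 2, so that `(N / n) ^ D` is at least
    -- `2 ^ s`. The union bound then asks `s` to exceed `9 * N * N + N`, which `N ^ 3` does once `N`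
    -- is at least 10. `m` is the least value that `m-large` permits.
    N s D m : ℕ
    N = suc n
    s = N * (N * N)
    D = n * s
    m = 16 * (N * D)

    instance
      n-nonZero : NonZero n
      n-nonZero = >-nonZero (≤-trans (s≤s z≤n) 9≤n)

  exponential-gap : 2 ^ s * n ^ D ≤ N ^ D
  exponential-gap = begin
    2 ^ s * n ^ D         ≡⟨ cong (2 ^ s *_) (^-*-assoc n n s) ⟨
    2 ^ s * (n ^ n) ^ s   ≡⟨ [m*n]^k≡m^k*n^k 2 (n ^ n) s ⟨
    (2 * n ^ n) ^ s       ≤⟨ ^-monoˡ-≤ s (2*n^n≤[1+n]^n n) ⟩
    (N ^ n) ^ s           ≡⟨ ^-*-assoc N n s ⟩
    N ^ D                 ∎
    where open ≤-Reasoning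

  pointers-small : m ≤ 2 ^ (9 * N)
  pointers-small = begin
    16 * (N * (n * (N * (N * N))))    ≤⟨ *-monoʳ-≤ 16 (*-monoʳ-≤ N (*-monoˡ-≤ s (n≤1+n n))) ⟩
    2 ^ 4 * (N * (N * (N * (N * N)))) ≡⟨ regroup (2 ^ 4) N ⟩
    2 ^ 4 * N ^ 5                     ≤⟨ *-mono-≤ (^-monoʳ-≤ 2 (*-monoʳ-≤ 4 (s≤s (z≤n {n}))))
                                                  (^-monoˡ-≤ 5 (<⇒≤ (n<2^n N))) ⟩
    2 ^ (4 * N) * (2 ^ N) ^ 5         ≡⟨ cong (2 ^ (4 * N) *_) (trans (^-*-assoc 2 N 5) (cong (2 ^_) (*-comm N 5))) ⟩
    2 ^ (4 * N) * 2 ^ (5 * N)         ≡⟨ ^-distribˡ-+-* 2 (4 * N) (5 * N) ⟨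
    2 ^ (4 * N + 5 * N)               ≡⟨ cong (2 ^_) (*-distribʳ-+ N 4 5) ⟨
    2 ^ (9 * N)                       ∎
    where
    open ≤-Reasoning
    regroup : ∀ c N → c * (N * (N * (N * (N * N)))) ≡ c * (N * (N * (N * (N * (N * 1)))))
    regroup = solve-∀

  admissible : Parameters n m D
  admissible = record
    { m-large = ≤-refl
    ; 2≤D     = *-mono-≤ {2} {n} {1} {s} (≤-trans (s≤s (s≤s z≤n)) 9≤n) (s≤s z≤n)
    ; union   = begin-strict
        m ^ N * n ^ D * 2 ^ N                   ≤⟨ *-monoˡ-≤ (2 ^ N) (*-monoˡ-≤ (n ^ D) (^-monoˡ-≤ N pointers-small)) ⟩
        (2 ^ (9 * N)) ^ N * n ^ D * 2 ^ N       ≡⟨ regroup ((2 ^ (9 * N)) ^ N) (n ^ D) (2 ^ N) ⟩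
        (2 ^ (9 * N)) ^ N * 2 ^ N * n ^ D       ≡⟨ cong (_* n ^ D) (trans (cong (_* 2 ^ N) (^-*-assoc 2 (9 * N) N)) (sym (^-distribˡ-+-* 2 (9 * N * N) N))) ⟩
        2 ^ (9 * N * N + N) * n ^ D             <⟨ *-monoˡ-< (n ^ D) {{m^n≢0 n D}} (^-monoʳ-< 2 (s≤s (s≤s z≤n)) exponents) ⟩
        2 ^ s * n ^ D                           ≤⟨ exponential-gap ⟩
        N ^ D                                   ∎
    }
    where
    open ≤-Reasoning
    regroup : ∀ a b c → a * b * c ≡ a * c * b
    regroup = solve-∀
    exponents : 9 * N * N + N < s
    exponents = begin-strict
      9 * N * N + N         <⟨ +-monoʳ-< (9 * N * N) (m<m*n N N (s≤s (≤-trans (s≤s z≤n) 9≤n))) ⟩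
      9 * N * N + N * N     ≡⟨ collect N ⟩
      10 * (N * N)          ≤⟨ *-monoˡ-≤ (N * N) (s≤s 9≤n) ⟩
      N * (N * N)           ∎
      where
      collect : ∀ N → 9 * N * N + N * N ≡ 10 * (N * N)
      collect = solve-∀

-- The family and its bounds

opaque
  -- The summand 16 makes the parameters admissible for every `n`; the quadratic term makes room for
  -- depth `n` and for a bisection of length linear in `n`.
  nodes slots width : ℕ → ℕ
  nodes n = 16 + n * n
  width n = nodes n * (suc (nodes n) * (suc (nodes n) * suc (nodes n)))
  slots n = 16 * (suc (nodes n) * width n)

  parameters : ∀ n → Parameters (nodes n) (slots n) (width n)
  parameters n = admissible (nodes n) (≤-trans (m≤m+n 9 7) (m≤m+n 16 (n * n)))

  nodes-≥ : ∀ n → n * n ≤ nodes n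
  nodes-≥ n = m≤n+m (n * n) 16

  nodes-polynomial : Polynomial nodes
  nodes-polynomial = polynomial-+ (polynomial-const 16) (polynomial-* polynomial-id polynomial-id)

  N-polynomial : Polynomial (suc ∘ nodes)
  N-polynomial = polynomial-+ (polynomial-const 1) nodes-polynomial

  slots-polynomial : Polynomial slots
  slots-polynomial = polynomial-* (polynomial-const 16) (polynomial-* N-polynomial
    (polynomial-* nodes-polynomial (polynomial-* N-polynomial (polynomial-* N-polynomial N-polynomial))))

slots-nonZero : ∀ n → NonZero (slots n)
slots-nonZero n = >-nonZero (≤-trans (*-mono-≤ {1} {16} (s≤s z≤n) (*-mono-≤ {1} {suc (nodes n)} (s≤s z≤n) (<⇒≤ 2≤D))) m-large)
  where open Parameters (parameters n)

vars : ℕ → ℕ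
vars n = Formula.variables (nodes n) (slots n)

family : ∀ n → CNF (vars n)
family n = Formula.formula (nodes n) (slots n)

axioms : ℕ → ℕ
axioms n = vars n + (vars n + length (family n))

capacity : ℕ → ℕ
capacity n = axioms n + suc (nodes n) * (suc (nodes n) * slots n) + (2 + slots n)

refutation : ∀ n → Refutation (encode (family n)) (Bounds.refutationSize (nodes n) (slots n) (capacity n) (suc (nodes n)))
refutation n = Bounds.refute (nodes n) (slots n) (capacity n) (suc (nodes n)) ≤-refl ≤-refl
                 (initialEnv (nodes n) (slots n))

-- Stated for arbitrary functions, since sums and products headed by a suc would unfold.
module _ {N m : ℕ → ℕ} (N-poly : Polynomial N) (m-poly : Polynomial m) where

  variables-polynomial : Polynomial (λ n → N n * m n + N n * (m n * N n))
  variables-polynomial = polynomial-+ (polynomial-* N-poly m-poly) (polynomial-* N-poly (polynomial-* m-poly N-poly))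

  length-polynomial : Polynomial (λ n → N n + (N n * m n + (m n + N n * (N n * N n) * (m n * m n))))
  length-polynomial = polynomial-+ N-poly (polynomial-+ (polynomial-* N-poly m-poly) (polynomial-+ m-poly
    (polynomial-* (polynomial-* N-poly (polynomial-* N-poly N-poly)) (polynomial-* m-poly m-poly))))

  capacity-polynomial : ∀ {a} → Polynomial a → Polynomial (λ n → a n + N n * (N n * m n) + (2 + m n))
  capacity-polynomial a-poly = polynomial-+
    (polynomial-+ a-poly (polynomial-* N-poly (polynomial-* N-poly m-poly)))
    (polynomial-+ {f = const 2} (polynomial-const 2) m-poly)

  leaf-polynomial : ∀ {c} → Polynomial c → Polynomial (λ n → 1 + (3 * c n + (N n * 3 + m n + 1)))
  leaf-polynomial c-poly = polynomial-+ {f = const 1} (polynomial-const 1)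
    (polynomial-+ (polynomial-* {f = const 3} (polynomial-const 3) c-poly)
                  (polynomial-+ (polynomial-+ (polynomial-* N-poly (polynomial-const 3)) m-poly) (polynomial-const 1)))

branch-polynomial : ∀ {v : ℕ → ℕ} → Polynomial v → Polynomial (λ n → 1 + 2 * (v n * 3 + 3))
branch-polynomial v-poly = polynomial-+ {f = const 1} (polynomial-const 1)
  (polynomial-* {f = const 2} (polynomial-const 2)
    (polynomial-+ (polynomial-* v-poly (polynomial-const 3)) (polynomial-const 3)))

module _ {N m b l : ℕ → ℕ} (N-poly : Polynomial N) (m-poly : Polynomial m)
         (b-poly : Polynomial b) (l-poly : Polynomial l) where

  reached-polynomial : Polynomial (λ n → m n * (b n + l n) + l n)
  reached-polynomial = polynomial-+ (polynomial-* m-poly (polynomial-+ b-poly l-poly)) l-poly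

  refutation-polynomial : Polynomial (λ n → N n * (N n * m n * (b n + l n)) + l n)
  refutation-polynomial = polynomial-+ (polynomial-* N-poly (polynomial-* (polynomial-* N-poly m-poly) (polynomial-+ b-poly l-poly))) l-poly

vars-polynomial : Polynomial vars
vars-polynomial = variables-polynomial N-polynomial slots-polynomial

axioms-polynomial : Polynomial axioms
axioms-polynomial = polynomial-+ vars-polynomial (polynomial-+ vars-polynomial
  (polynomial-≤ (λ n → formulaLength (nodes n) (slots n)) (length-polynomial N-polynomial slots-polynomial)))

size-polynomial : Polynomial (λ n → Bounds.refutationSize (nodes n) (slots n) (capacity n) (suc (nodes n)))
size-polynomial = refutation-polynomial N-polynomial slots-polynomial branches
  (reached-polynomial N-polynomial slots-polynomial branches leaves)
  where
  capacities : Polynomial capacity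
  capacities = capacity-polynomial N-polynomial slots-polynomial axioms-polynomial
  branches : Polynomial (λ n → branch {vars n})
  branches = branch-polynomial vars-polynomial
  leaves : Polynomial (λ n → Bounds.leafSize (nodes n) (slots n) (capacity n))
  leaves = leaf-polynomial N-polynomial slots-polynomial capacities

-- `C + n * k` serves as a crude logarithm of the number of inequalities: it is linear in `n`,
-- whereas `nodes n` is quadratic, so it fits next to a depth below `n`.
depth-≥ : ∃[ N₀ ] ∀ n → n ≥ N₀ → (π : SPRefutation (family n)) → n ≤ depth π
depth-≥ with C , k , axioms≤ ← polynomial-+ axioms-polynomial polynomial-id =
  C + k + 3 , λ n n≥ π → ≮⇒≥ λ shallow →
    depth-bound {{slots-nonZero n}} (parameters n) (C + n * k) π (room n n≥ (<⇒≤ shallow))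
      (≤-trans (+-monoʳ-≤ (axioms n) (<⇒≤ shallow)) (≤-trans (axioms≤ n) (begin
        C * suc n ^ k            ≤⟨ *-mono-≤ (<⇒≤ (n<2^n C)) (^-monoˡ-≤ k (n<2^n n)) ⟩
        2 ^ C * (2 ^ n) ^ k      ≡⟨ cong (2 ^ C *_) (^-*-assoc 2 n k) ⟩
        2 ^ C * 2 ^ (n * k)      ≡⟨ ^-distribˡ-+-* 2 C (n * k) ⟨
        2 ^ (C + n * k)          ∎)))
  where
  open ≤-Reasoning
  room : ∀ n → n ≥ C + k + 3 → ∀ {d} → d ≤ n → d + (C + n * k) + 2 ≤ suc (nodes n)
  room n n≥ {d} d≤n = begin
    d + (C + n * k) + 2           ≤⟨ +-monoˡ-≤ 2 (+-monoˡ-≤ (C + n * k) d≤n) ⟩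
    n + (C + n * k) + 2           ≤⟨ +-mono-≤ (+-monoʳ-≤ n (+-monoˡ-≤ (n * k) (m≤n*m C n {{n-nonZero}}))) (m≤n*m 2 n {{n-nonZero}}) ⟩
    n + (n * C + n * k) + n * 2   ≡⟨ regroup n C k ⟩
    n * (C + k + 3)               ≤⟨ *-monoʳ-≤ n n≥ ⟩
    n * n                         ≤⟨ nodes-≥ n ⟩
    nodes n                       ≤⟨ n≤1+n (nodes n) ⟩
    suc (nodes n)                 ∎
    where
    n-nonZero : NonZero n
    n-nonZero = >-nonZero (≤-trans (≤-trans (s≤s z≤n) (m≤n+m 3 (C + k))) n≥)
    regroup : ∀ n C k → n + (n * C + n * k) + n * 2 ≡ n * (C + k + 3)
    regroup = solve-∀

m≤m^8 : ∀ m → m ≤ m ^ 8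
m≤m^8 zero    = z≤n
m≤m^8 (suc m) = ≤-trans (≤-reflexive (sym (*-identityʳ (suc m)))) (^-monoʳ-≤ (suc m) {1} {8} (s≤s z≤n))

corollary6p3 : Σ[ vars ∈ (ℕ → ℕ) ] Σ[ F ∈ ((n : ℕ) → CNF (vars n)) ]
    ( (∀ n → Unsatisfiable (F n))
    × (∃[ C ] ∃[ k ] ∀ n → Σ[ π ∈ SPRefutation (F n) ] size π ≤ C * n ^ k + C)
    × (∃[ C ] ∃[ N ] ∀ n → n ≥ N → (π : SPRefutation (F n)) → n ≤ (C * (depth π * ⌊log₂ n ⌋)) ^ 8)
    )
corollary6p3 = vars , family
  , (λ n → refutation⇒unsatisfiable (proj₁ (refutation n)))
  , (let C , k , small = polynomial⇒ size-polynomial in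
     C , k , λ n → proj₁ (refutation n) , ≤-trans (proj₂ (refutation n)) (small n))
  , (let N , deep = depth-≥ in
     -- From 2 onwards the logarithm is at least 1, so `n ≤ depth π` survives multiplication by it
     -- and the eighth power.
     1 , 2 + N , λ n n≥ π → begin
       n                                        ≤⟨ deep n (≤-trans (m≤n+m N 2) n≥) π ⟩
       depth π                                  ≡⟨ *-identityʳ (depth π) ⟨
       depth π * 1                              ≤⟨ *-monoʳ-≤ (depth π) (⌊log₂⌋-mono-≤ (≤-trans (m≤m+n 2 N) n≥)) ⟩
       depth π * ⌊log₂ n ⌋                      ≡⟨ *-identityˡ (depth π * ⌊log₂ n ⌋) ⟨
       1 * (depth π * ⌊log₂ n ⌋)                ≤⟨ m≤m^8 _ ⟩
       (1 * (depth π * ⌊log₂ n ⌋)) ^ 8          ∎)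
  where open ≤-Reasoning
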